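{- Let $\omega=e^{2\pi i/6}$, choose a sign $\pm$, and let $r\in\mathbb C\setminus\{0,\omega^{\pm1}\}$. Let $\Psi^\pm_r:\mathsf{PGL}_2(\mathbb Z)\to\mathsf{PGL}_2(\mathbb C)$ be the homomorphism with $$\Psi^\pm_r(T)=\begin{bmatrix}r&1\\0&1\end{bmatrix},\quad \Psi^\pm_r(S)=\begin{bmatrix}1&r^{ -1}\\ -r+\omega^{\pm1}&-1\end{bmatrix},\quad \Psi^\pm_r(V)=\begin{bmatrix}1&\frac{1+r^{ -1}}{r-\omega^{\pm1}}\\ 1-r&-1\end{bmatrix}.$$ Then there exists $M\in\mathsf{PGL}_2(\mathbb C)$ with $M\,\Psi^\pm_r(g)\,M^{ -1}=\alpha(g)$ for all $g\in\mathsf{PGL}_2(\mathbb Z)$ (equivalently $M\Psi^\pm_r(U)M^{ -1}=U$, $M\Psi^\pm_r(K)M^{ -1}=K$, $M\Psi^\pm_r(V)M^{ -1}=UV$) if and only if $r=-\varphi^2$ or $r=-\bar\varphi^2$.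
   Context: $\varphi=\frac{1+\sqrt5}{2}$, $\bar\varphi=\frac{1-\sqrt5}{2}$. An invertible matrix $\begin{bmatrix}a&b\\c&d\end{bmatrix}$ denotes the Möbius map $x\mapsto(ax+b)/(cx+d)$. In $\mathsf{PGL}_2(\mathbb Z)$: $T(x)=1+x$, $S(x)=-1/x$, $U(x)=1/x$, $V(x)=-x$, $K(x)=1-x$; $T,S,V$ generate $\mathsf{PGL}_2(\mathbb Z)$. Dyer's outer automorphism $\alpha$ of $\mathsf{PGL}_2(\mathbb Z)$ is the involutive automorphism with $\alpha(U)=U$, $\alpha(K)=K$, $\alpha(V)=UV$ (so $\alpha(T)=TU$, $\alpha(S)=V$). -}

module Defs where

open import Algebra.Apartness.Bundles using (HeytingCommutativeRing; HeytingField)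
import Algebra.Apartness.Properties.HeytingCommutativeRing
open import Algebra.Bundles using (CommutativeRing; Group)
import Algebra.Definitions
open import Algebra.Morphism.Structures using (module GroupMorphisms)
import Algebra.Properties.AbelianGroup
import Algebra.Properties.Ring
import Algebra.Properties.Semiring.Mult.TCOptimised
import Algebra.Solver.Ring
open import Algebra.Solver.Ring.AlmostCommutativeRing using (fromCommutativeRing; _-Raw-AlmostCommutative⟶_; Induced-equivalence)
open import Algebra.Structures using (IsCommutativeRing; IsGroup)
open import Data.Empty using (⊥-elim)
open import Data.Integer.Base as ℤ using (ℤ; +_; -[1+_]; _⊖_; 0ℤ; 1ℤ; -1ℤ)
import Data.Integer.Properties as ℤ
open import Data.Maybe.Base using (just; nothing)
open import Data.Nat.Base as ℕ using (ℕ; zero; suc)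
import Data.Nat.Properties as ℕ
open import Data.Product.Base using (∃-syntax; _×_; _,_; proj₁; proj₂)
open import Data.Rational.Base as ℚ using (ℚ; mkℚ; 0ℚ; 1ℚ; ½; ∣_∣)
import Data.Rational.Properties as ℚ
open import Data.Rational.Solver using (module +-*-Solver)
import Data.Rational.Unnormalised.Base as ℚᵘ
import Data.Rational.Unnormalised.Properties as ℚᵘ
open import Data.Sign.Base as Sign using (Sign)
open import Data.Sum.Base as Sum using (_⊎_; inj₁; inj₂; [_,_]′)
open import Function.Base using (id)
open import Level using (0ℓ; _⊔_)
open import Relation.Binary.Definitions using (Tight; WeaklyDecidable)
open import Relation.Binary.PropositionalEquality as ≡ using (_≡_)
import Relation.Binary.Reasoning.Setoid
open import Relation.Binary.Structures using (IsApartnessRelation)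
open import Relation.Nullary.Decidable.Core using (yes; no)
open import Relation.Nullary.Negation.Core using (¬_)

module Integers {c ℓ} (R : CommutativeRing c ℓ) where
  open CommutativeRing R hiding (zero)
  open Algebra.Properties.Ring ring using (-‿distribˡ-*; -‿distribʳ-*; -‿involutive; -0#≈0#)
  open Algebra.Properties.AbelianGroup +-abelianGroup using (⁻¹-∙-comm; ⁻¹-anti-homo‿-)
  private
    module M = Algebra.Properties.Semiring.Mult.TCOptimised semiring
  open Relation.Binary.Reasoning.Setoid setoid

  fromℕ : ℕ → Carrier
  fromℕ n = n M.× 1#

  fromℤ : ℤ → Carrier
  fromℤ (+ n)    = fromℕ n
  fromℤ -[1+ n ] = - fromℕ (suc n)

  fromℤ-neg : ∀ i → fromℤ (ℤ.- i) ≈ - fromℤ i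
  fromℤ-neg (+ zero)  = sym -0#≈0#
  fromℤ-neg (+ suc n) = refl
  fromℤ-neg -[1+ n ]  = sym (-‿involutive _)

  fromℤ-⊖ : ∀ m n → fromℤ (m ⊖ n) ≈ fromℕ m - fromℕ n
  fromℤ-⊖ m zero = begin
    fromℕ m         ≈⟨ +-identityʳ _ ⟨
    fromℕ m + 0#    ≈⟨ +-congˡ -0#≈0# ⟨
    fromℕ m + - 0#  ∎
  fromℤ-⊖ zero (suc n) = sym (+-identityˡ _)
  fromℤ-⊖ (suc m) (suc n) = begin
    fromℤ (suc m ⊖ suc n)                        ≡⟨ ≡.cong fromℤ (ℤ.[1+m]⊖[1+n]≡m⊖n m n) ⟩
    fromℤ (m ⊖ n)                                ≈⟨ fromℤ-⊖ m n ⟩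
    fromℕ m - fromℕ n                            ≈⟨ +-identityˡ _ ⟨
    0# + (fromℕ m - fromℕ n)                     ≈⟨ +-congʳ (-‿inverseʳ 1#) ⟨
    (1# - 1#) + (fromℕ m - fromℕ n)              ≈⟨ interchange 1# (- 1#) _ _ ⟩
    (1# + fromℕ m) + (- 1# - fromℕ n)            ≈⟨ +-congˡ (⁻¹-∙-comm _ _) ⟩
    (1# + fromℕ m) - (1# + fromℕ n)              ≈⟨ +-cong (M.1+× m 1#) (-‿cong (M.1+× n 1#)) ⟨
    fromℕ (suc m) - fromℕ (suc n)                ∎
    where
    interchange : ∀ w x y z → (w + x) + (y + z) ≈ (w + y) + (x + z)
    interchange w x y z = begin
      (w + x) + (y + z)  ≈⟨ +-assoc w x _ ⟩
      w + (x + (y + z))  ≈⟨ +-congˡ (+-assoc x y z) ⟨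
      w + ((x + y) + z)  ≈⟨ +-congˡ (+-congʳ (+-comm x y)) ⟩
      w + ((y + x) + z)  ≈⟨ +-congˡ (+-assoc y x z) ⟩
      w + (y + (x + z))  ≈⟨ +-assoc w y _ ⟨
      (w + y) + (x + z)  ∎

  fromℤ-+ : ∀ i j → fromℤ (i ℤ.+ j) ≈ fromℤ i + fromℤ j
  fromℤ-+ (+ m)    (+ n)    = M.×-homo-+ 1# m n
  fromℤ-+ (+ m)    -[1+ n ] = fromℤ-⊖ m (suc n)
  fromℤ-+ -[1+ m ] (+ n)    = trans (fromℤ-⊖ n (suc m)) (+-comm _ _)
  fromℤ-+ -[1+ m ] -[1+ n ] = begin
    - fromℕ (suc (suc (m ℕ.+ n)))      ≡⟨ ≡.cong (λ k → - fromℕ (suc k)) (ℕ.+-suc m n) ⟨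
    - fromℕ (suc m ℕ.+ suc n)          ≈⟨ -‿cong (M.×-homo-+ 1# (suc m) (suc n)) ⟩
    - (fromℕ (suc m) + fromℕ (suc n))  ≈⟨ ⁻¹-∙-comm _ _ ⟨
    - fromℕ (suc m) - fromℕ (suc n)    ∎

  private
    pos : ∀ n → fromℤ (Sign.+ ℤ.◃ n) ≈ fromℕ n
    pos n = reflexive (≡.cong fromℤ (ℤ.+◃n≡+n n))

    neg : ∀ n → fromℤ (Sign.- ℤ.◃ n) ≈ - fromℕ n
    neg n = trans (reflexive (≡.cong fromℤ (ℤ.-◃n≡-n n))) (fromℤ-neg (+ n))

  fromℤ-* : ∀ i j → fromℤ (i ℤ.* j) ≈ fromℤ i * fromℤ j
  fromℤ-* (+ m)    (+ n)    = trans (pos (m ℕ.* n)) (M.×1-homo-* m n)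
  fromℤ-* (+ m)    -[1+ n ] = begin
    fromℤ (Sign.- ℤ.◃ (m ℕ.* suc n))  ≈⟨ neg (m ℕ.* suc n) ⟩
    - fromℕ (m ℕ.* suc n)             ≈⟨ -‿cong (M.×1-homo-* m (suc n)) ⟩
    - (fromℕ m * fromℕ (suc n))       ≈⟨ -‿distribʳ-* _ _ ⟩
    fromℕ m * - fromℕ (suc n)         ∎
  fromℤ-* -[1+ m ] (+ n)    = begin
    fromℤ (Sign.- ℤ.◃ (suc m ℕ.* n))  ≈⟨ neg (suc m ℕ.* n) ⟩
    - fromℕ (suc m ℕ.* n)             ≈⟨ -‿cong (M.×1-homo-* (suc m) n) ⟩
    - (fromℕ (suc m) * fromℕ n)       ≈⟨ -‿distribˡ-* _ _ ⟩
    - fromℕ (suc m) * fromℕ n         ∎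
  fromℤ-* -[1+ m ] -[1+ n ] = begin
    fromℕ (suc m ℕ.* suc n)              ≈⟨ M.×1-homo-* (suc m) (suc n) ⟩
    fromℕ (suc m) * fromℕ (suc n)        ≈⟨ -‿involutive _ ⟨
    - - (fromℕ (suc m) * fromℕ (suc n))  ≈⟨ -‿cong (-‿distribʳ-* _ _) ⟩
    - (fromℕ (suc m) * - fromℕ (suc n))  ≈⟨ -‿distribˡ-* _ _ ⟩
    - fromℕ (suc m) * - fromℕ (suc n)    ∎

  private
    ℤ⟶R : ℤ.+-*-rawRing -Raw-AlmostCommutative⟶ fromCommutativeRing R
    ℤ⟶R = record
      { ⟦_⟧    = fromℤ
      ; +-homo = fromℤ-+
      ; *-homo = fromℤ-*
      ; -‿homo = fromℤ-neg
      ; 0-homo = refl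
      ; 1-homo = refl
      }

    _≟_ : WeaklyDecidable (Induced-equivalence ℤ⟶R)
    i ≟ j with i ℤ.≟ j
    ... | yes i≡j = just (reflexive (≡.cong fromℤ i≡j))
    ... | no _    = nothing

  module Solver = Algebra.Solver.Ring ℤ.+-*-rawRing (fromCommutativeRing R) ℤ⟶R _≟_

module Projective {c ℓ} (R : CommutativeRing c ℓ) where
  open CommutativeRing R hiding (zero)
  open Algebra.Definitions _≈_ using (Invertible)
  open Relation.Binary.Reasoning.Setoid setoid
  open Integers.Solver R

  Unit : Carrier → Set (c ⊔ ℓ)
  Unit = Invertible 1# _*_

  unit : ∀ {x} y → x * y ≈ 1# → Unit x
  unit y xy≈1 = y , trans (*-comm _ _) xy≈1 , xy≈1

  abstract
    Unit-1 : Unit 1#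
    Unit-1 = unit 1# (*-identityˡ 1#)

    Unit-* : ∀ {x y} → Unit x → Unit y → Unit (x * y)
    Unit-* {x} {y} (x⁻¹ , _ , xx⁻¹≈1) (y⁻¹ , _ , yy⁻¹≈1) = unit (x⁻¹ * y⁻¹) (begin
      (x * y) * (x⁻¹ * y⁻¹)  ≈⟨ solve 4 (λ x y u v → (x :* y) :* (u :* v) := (x :* u) :* (y :* v)) refl x y x⁻¹ y⁻¹ ⟩
      (x * x⁻¹) * (y * y⁻¹)  ≈⟨ *-cong xx⁻¹≈1 yy⁻¹≈1 ⟩
      1# * 1#                ≈⟨ *-identityˡ 1# ⟩
      1#                     ∎)

    Unit-resp : ∀ {x y} → x ≈ y → Unit x → Unit y
    Unit-resp x≈y (x⁻¹ , _ , xx⁻¹≈1) = unit x⁻¹ (trans (*-congʳ (sym x≈y)) xx⁻¹≈1)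

  record Mat₂ : Set c where
    constructor [_,_∣_,_]
    field
      e₁₁ e₁₂ e₂₁ e₂₂ : Carrier

  det : Mat₂ → Carrier
  det [ a , b ∣ c , d ] = a * d - b * c

  infixl 7 _·_
  _·_ : Mat₂ → Mat₂ → Mat₂
  [ a , b ∣ c , d ] · [ a′ , b′ ∣ c′ , d′ ] =
    [ a * a′ + b * c′ , a * b′ + b * d′ ∣ c * a′ + d * c′ , c * b′ + d * d′ ]

  adj : Mat₂ → Mat₂
  adj [ a , b ∣ c , d ] = [ d , - b ∣ - c , a ]

  I : Mat₂
  I = [ 1# , 0# ∣ 0# , 1# ]

  infixr 8 _⊙_
  _⊙_ : Carrier → Mat₂ → Mat₂
  k ⊙ [ a , b ∣ c , d ] = [ k * a , k * b ∣ k * c , k * d ]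

  infix 4 _≋_
  record _≋_ (A B : Mat₂) : Set ℓ where
    constructor mk≋
    private
      module A = Mat₂ A
      module B = Mat₂ B
    field
      ≈₁₁ : A.e₁₁ ≈ B.e₁₁
      ≈₁₂ : A.e₁₂ ≈ B.e₁₂
      ≈₂₁ : A.e₂₁ ≈ B.e₂₁
      ≈₂₂ : A.e₂₂ ≈ B.e₂₂

  -- An element of PGL₂(R) is given by a representing matrix in GL₂(R); the
  -- passage to the quotient by the scalars R^× is the equality _∼_.
  record GL₂ : Set (c ⊔ ℓ) where
    no-eta-equality
    pattern
    constructor gl
    field
      matrix   : Mat₂
      det-unit : Unit (det matrix)
  open GL₂ public

  infix 4 _∼_
  record _∼_ (A B : GL₂) : Set (c ⊔ ℓ) where
    constructor scaled
    field
      scalar      : Carrier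
      scalar-unit : Unit scalar
      equal       : matrix A ≋ scalar ⊙ matrix B

  abstract
    det-· : ∀ A B → det (A · B) ≈ det A * det B
    det-· [ a , b ∣ c , d ] [ a′ , b′ ∣ c′ , d′ ] =
      solve 8 (λ a b c d a′ b′ c′ d′ →
        (a :* a′ :+ b :* c′) :* (c :* b′ :+ d :* d′) :- (a :* b′ :+ b :* d′) :* (c :* a′ :+ d :* c′)
          := (a :* d :- b :* c) :* (a′ :* d′ :- b′ :* c′))
        refl a b c d a′ b′ c′ d′

    det-adj : ∀ A → det (adj A) ≈ det A
    det-adj [ a , b ∣ c , d ] =
      solve 4 (λ a b c d → d :* a :- (:- b) :* (:- c) := a :* d :- b :* c) refl a b c d

    det-I : det I ≈ 1#
    det-I = solve 0 (con (+ 1) :* con (+ 1) :- con (+ 0) :* con (+ 0) := con (+ 1)) refl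

  infixl 7 _∙_
  _∙_ : GL₂ → GL₂ → GL₂
  A ∙ B = gl (matrix A · matrix B) (Unit-resp (sym (det-· _ _)) (Unit-* (det-unit A) (det-unit B)))

  ε : GL₂
  ε = gl I (Unit-resp (sym det-I) Unit-1)

  -- Up to scalars, the inverse is the adjugate.
  infix 8 _⁻¹
  _⁻¹ : GL₂ → GL₂
  A ⁻¹ = gl (adj (matrix A)) (Unit-resp (sym (det-adj _)) (det-unit A))

  ≋⇒∼ : ∀ {A B} → matrix A ≋ matrix B → A ∼ B
  ≋⇒∼ (mk≋ p q r s) = scaled 1# Unit-1 (mk≋ (f p) (f q) (f r) (f s))
    where
    f : ∀ {x y} → x ≈ y → x ≈ 1# * y
    f x≈y = trans x≈y (sym (*-identityˡ _))

  ∼-refl : ∀ {A} → A ∼ A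
  ∼-refl = ≋⇒∼ (mk≋ refl refl refl refl)

  ∼-sym : ∀ {A B} → A ∼ B → B ∼ A
  ∼-sym (scaled k (k⁻¹ , k⁻¹k≈1 , kk⁻¹≈1) (mk≋ p q r s)) =
    scaled k⁻¹ (k , kk⁻¹≈1 , k⁻¹k≈1) (mk≋ (f p) (f q) (f r) (f s))
    where
    f : ∀ {x y} → x ≈ k * y → y ≈ k⁻¹ * x
    f {x} {y} x≈ky = begin
      y              ≈⟨ *-identityˡ y ⟨
      1# * y         ≈⟨ *-congʳ k⁻¹k≈1 ⟨
      k⁻¹ * k * y    ≈⟨ *-assoc k⁻¹ k y ⟩
      k⁻¹ * (k * y)  ≈⟨ *-congˡ x≈ky ⟨
      k⁻¹ * x        ∎

  ∼-trans : ∀ {A B C} → A ∼ B → B ∼ C → A ∼ C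
  ∼-trans (scaled k u (mk≋ p q r s)) (scaled l v (mk≋ p′ q′ r′ s′)) =
    scaled (k * l) (Unit-* u v) (mk≋ (f p p′) (f q q′) (f r r′) (f s s′))
    where
    f : ∀ {x y z} → x ≈ k * y → y ≈ l * z → x ≈ k * l * z
    f x≈ky y≈lz = trans x≈ky (trans (*-congˡ y≈lz) (sym (*-assoc k l _)))

  ∙-cong : ∀ {A A′ B B′} → A ∼ A′ → B ∼ B′ → A ∙ B ∼ A′ ∙ B′
  ∙-cong (scaled k u (mk≋ p q r s)) (scaled l v (mk≋ p′ q′ r′ s′)) =
    scaled (k * l) (Unit-* u v) (mk≋ (f p p′ q r′) (f p q′ q s′) (f r p′ s r′) (f r q′ s s′))
    where
    f : ∀ {w w′ x x′ y y′ z z′} → w ≈ k * w′ → x ≈ l * x′ → y ≈ k * y′ → z ≈ l * z′ →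
        w * x + y * z ≈ k * l * (w′ * x′ + y′ * z′)
    f {w} {w′} {x} {x′} {y} {y′} {z} {z′} a b c d = begin
      w * x + y * z                                  ≈⟨ +-cong (*-cong a b) (*-cong c d) ⟩
      k * w′ * (l * x′) + k * y′ * (l * z′)          ≈⟨ solve 6 (λ k l w x y z → k :* w :* (l :* x) :+ k :* y :* (l :* z) := k :* l :* (w :* x :+ y :* z)) refl k l w′ x′ y′ z′ ⟩
      k * l * (w′ * x′ + y′ * z′)                    ∎

  ∙-assoc : ∀ A B C → (A ∙ B) ∙ C ∼ A ∙ (B ∙ C)
  ∙-assoc A B C = ≋⇒∼ (mk≋ (f _ _ _ _ _ _ _ _) (f _ _ _ _ _ _ _ _) (f _ _ _ _ _ _ _ _) (f _ _ _ _ _ _ _ _))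
    where
    f : ∀ a b p q r s x y → (a * p + b * q) * x + (a * r + b * s) * y ≈ a * (p * x + r * y) + b * (q * x + s * y)
    f = solve 8 (λ a b p q r s x y →
      (a :* p :+ b :* q) :* x :+ (a :* r :+ b :* s) :* y
        := a :* (p :* x :+ r :* y) :+ b :* (q :* x :+ s :* y)) refl

  ∙-identityˡ : ∀ A → ε ∙ A ∼ A
  ∙-identityˡ A = ≋⇒∼ (mk≋ (f _ _) (f _ _) (g _ _) (g _ _))
    where
    f : ∀ x y → 1# * x + 0# * y ≈ x
    f = solve 2 (λ x y → con (+ 1) :* x :+ con (+ 0) :* y := x) refl
    g : ∀ x y → 0# * x + 1# * y ≈ y
    g = solve 2 (λ x y → con (+ 0) :* x :+ con (+ 1) :* y := y) refl

  ∙-identityʳ : ∀ A → A ∙ ε ∼ A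
  ∙-identityʳ A = ≋⇒∼ (mk≋ (f _ _) (g _ _) (f _ _) (g _ _))
    where
    f : ∀ x y → x * 1# + y * 0# ≈ x
    f = solve 2 (λ x y → x :* con (+ 1) :+ y :* con (+ 0) := x) refl
    g : ∀ x y → x * 0# + y * 1# ≈ y
    g = solve 2 (λ x y → x :* con (+ 0) :+ y :* con (+ 1) := y) refl

  ⁻¹-inverseˡ : ∀ A → A ⁻¹ ∙ A ∼ ε
  ⁻¹-inverseˡ A@(gl [ a , b ∣ c , d ] u) = scaled (det (matrix A)) u (mk≋
    (solve 4 (λ a b c d → d :* a :+ (:- b) :* c := (a :* d :- b :* c) :* con (+ 1)) refl a b c d)
    (solve 4 (λ a b c d → d :* b :+ (:- b) :* d := (a :* d :- b :* c) :* con (+ 0)) refl a b c d)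
    (solve 4 (λ a b c d → (:- c) :* a :+ a :* c := (a :* d :- b :* c) :* con (+ 0)) refl a b c d)
    (solve 4 (λ a b c d → (:- c) :* b :+ a :* d := (a :* d :- b :* c) :* con (+ 1)) refl a b c d))

  ⁻¹-inverseʳ : ∀ A → A ∙ A ⁻¹ ∼ ε
  ⁻¹-inverseʳ A@(gl [ a , b ∣ c , d ] u) = scaled (det (matrix A)) u (mk≋
    (solve 4 (λ a b c d → a :* d :+ b :* (:- c) := (a :* d :- b :* c) :* con (+ 1)) refl a b c d)
    (solve 4 (λ a b c d → a :* (:- b) :+ b :* a := (a :* d :- b :* c) :* con (+ 0)) refl a b c d)
    (solve 4 (λ a b c d → c :* d :+ d :* (:- c) := (a :* d :- b :* c) :* con (+ 0)) refl a b c d)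
    (solve 4 (λ a b c d → c :* (:- b) :+ d :* a := (a :* d :- b :* c) :* con (+ 1)) refl a b c d))

  ⁻¹-cong : ∀ {A B} → A ∼ B → A ⁻¹ ∼ B ⁻¹
  ⁻¹-cong (scaled k u (mk≋ p q r s)) = scaled k u (mk≋ s (f q) (f r) p)
    where
    f : ∀ {x y} → x ≈ k * y → - x ≈ k * - y
    f {y = y} x≈ky = trans (-‿cong x≈ky) (solve 2 (λ k y → :- (k :* y) := k :* (:- y)) refl k y)

  opaque
    PGL₂-isGroup : IsGroup _∼_ _∙_ ε _⁻¹
    PGL₂-isGroup = record
      { isMonoid = record
        { isSemigroup = record
          { isMagma = record
            { isEquivalence = record { refl = λ {A} → ∼-refl {A} ; sym = λ {A} {B} → ∼-sym {A} {B} ; trans = λ {A} {B} {C} → ∼-trans {A} {B} {C} }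
            ; ∙-cong        = λ {A} {B} {C} {D} → ∙-cong {A} {B} {C} {D}
            }
          ; assoc = ∙-assoc
          }
        ; identity = ∙-identityˡ , ∙-identityʳ
        }
      ; inverse = ⁻¹-inverseˡ , ⁻¹-inverseʳ
      ; ⁻¹-cong = λ {A} {B} → ⁻¹-cong {A} {B}
      }

  PGL₂ : Group (c ⊔ ℓ) (c ⊔ ℓ)
  PGL₂ = record
    { Carrier = GL₂
    ; _≈_     = _∼_
    ; _∙_     = _∙_
    ; ε       = ε
    ; _⁻¹     = _⁻¹
    ; isGroup = PGL₂-isGroup
    }

module Reals where
  Eventually : (ℕ → Set) → Set
  Eventually P = ∃[ N ] ∀ n → N ℕ.≤ n → P n

  IsCauchy : (ℕ → ℚ) → Set
  IsCauchy s = ∀ ε → 0ℚ ℚ.< ε → ∃[ N ] ∀ m n → N ℕ.≤ m → N ℕ.≤ n → ∣ s m ℚ.- s n ∣ ℚ.< ε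

  -- Cauchy reals: sequences of rationals with a modulus of convergence, modulo
  -- null sequences. Apartness _#ᴿ_ (distance bounded away from 0) is the
  -- constructive form of ≠; classically the two coincide.
  record ℝ : Set where
    no-eta-equality
    pattern
    constructor real
    field
      seq    : ℕ → ℚ
      cauchy : IsCauchy seq
  open ℝ public

  infix 4 _≈ᴿ_ _#ᴿ_

  record _≈ᴿ_ (x y : ℝ) : Set where
    constructor mk≈
    field
      null : ∀ ε → 0ℚ ℚ.< ε → Eventually (λ n → ∣ seq x n ℚ.- seq y n ∣ ℚ.< ε)

  record _#ᴿ_ (x y : ℝ) : Set where
    constructor mk#
    field
      gap   : ℚ
      0<gap : 0ℚ ℚ.< gap
      away  : Eventually (λ n → gap ℚ.≤ ∣ seq x n ℚ.- seq y n ∣)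

  open +-*-Solver

  private
    both : ∀ {P Q : ℕ → Set} → Eventually P → Eventually Q → Eventually (λ n → P n × Q n)
    both (M , p) (N , q) = M ℕ.⊔ N , λ n ≤n →
      p n (ℕ.≤-trans (ℕ.m≤m⊔n M N) ≤n) , q n (ℕ.≤-trans (ℕ.m≤n⊔m M N) ≤n)

    map : ∀ {P Q : ℕ → Set} → (∀ n → P n → Q n) → Eventually P → Eventually Q
    map f (N , p) = N , λ n ≤n → f n (p n ≤n)

    half : ℚ → ℚ
    half ε = ½ ℚ.* ε

    half+half : ∀ ε → half ε ℚ.+ half ε ≡ ε
    half+half = solve 1 (λ x → con ½ :* x :+ con ½ :* x := x) ≡.refl

    *-pos : ∀ {p q} → 0ℚ ℚ.< p → 0ℚ ℚ.< q → 0ℚ ℚ.< p ℚ.* q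
    *-pos {p} {q} 0<p 0<q = ℚ.positive⁻¹ _ {{ℚ.pos*pos⇒pos p {{ℚ.positive 0<p}} q {{ℚ.positive 0<q}}}}

    0<½ : 0ℚ ℚ.< ½
    0<½ = ℚ.positive⁻¹ ½

    half-pos : ∀ {ε} → 0ℚ ℚ.< ε → 0ℚ ℚ.< half ε
    half-pos = *-pos 0<½

    +-halves : ∀ {p q} ε → p ℚ.< half ε → q ℚ.< half ε → p ℚ.+ q ℚ.< ε
    +-halves ε p< q< = ≡.subst (_ ℚ.<_) (half+half ε) (ℚ.+-mono-< p< q<)

    ∣-∣-sym : ∀ p q → ∣ p ℚ.- q ∣ ≡ ∣ q ℚ.- p ∣
    ∣-∣-sym p q = ≡.trans (≡.cong ∣_∣ (solve 2 (λ p q → p :- q := :- (q :- p)) ≡.refl p q)) (ℚ.∣-p∣≡∣p∣ (q ℚ.- p))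

    triangle : ∀ p q r → ∣ p ℚ.- r ∣ ℚ.≤ ∣ p ℚ.- q ∣ ℚ.+ ∣ q ℚ.- r ∣
    triangle p q r = ≡.subst (λ t → ∣ t ∣ ℚ.≤ ∣ p ℚ.- q ∣ ℚ.+ ∣ q ℚ.- r ∣)
      (solve 3 (λ p q r → (p :- q) :+ (q :- r) := p :- r) ≡.refl p q r)
      (ℚ.∣p+q∣≤∣p∣+∣q∣ (p ℚ.- q) (q ℚ.- r))

    ∣∣-triangle : ∀ p q → ∣ p ∣ ℚ.≤ ∣ q ∣ ℚ.+ ∣ p ℚ.- q ∣
    ∣∣-triangle p q = ≡.subst (λ t → ∣ t ∣ ℚ.≤ ∣ q ∣ ℚ.+ ∣ p ℚ.- q ∣)
      (solve 2 (λ p q → q :+ (p :- q) := p) ≡.refl p q)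
      (ℚ.∣p+q∣≤∣p∣+∣q∣ q (p ℚ.- q))

    *-mono-≤ : ∀ {p q r s} → 0ℚ ℚ.≤ p → 0ℚ ℚ.≤ s → p ℚ.≤ q → r ℚ.≤ s → p ℚ.* r ℚ.≤ q ℚ.* s
    *-mono-≤ {p} {q} {r} {s} 0≤p 0≤s p≤q r≤s = ℚ.≤-trans
      (ℚ.*-monoˡ-≤-nonNeg p {{ℚ.nonNegative 0≤p}} r≤s)
      (ℚ.*-monoʳ-≤-nonNeg s {{ℚ.nonNegative 0≤s}} p≤q)

    p≤q+r⇒p-r≤q : ∀ {p q r} → p ℚ.≤ q ℚ.+ r → p ℚ.- r ℚ.≤ q
    p≤q+r⇒p-r≤q {p} {q} {r} p≤q+r = ≡.subst (p ℚ.- r ℚ.≤_)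
      (solve 2 (λ q r → (q :+ r) :- r := q) ≡.refl q r) (ℚ.+-monoˡ-≤ (ℚ.- r) p≤q+r)

    ∣x-x∣<ε : ∀ p {ε} → 0ℚ ℚ.< ε → ∣ p ℚ.- p ∣ ℚ.< ε
    ∣x-x∣<ε p 0<ε = ≡.subst (λ t → ∣ t ∣ ℚ.< _) (≡.sym (ℚ.+-inverseʳ p)) 0<ε

    0<a+1 : ∀ p → 0ℚ ℚ.< ∣ p ∣ ℚ.+ 1ℚ
    0<a+1 p = ℚ.≤-<-trans (ℚ.0≤∣p∣ p) (≡.subst (ℚ._< ∣ p ∣ ℚ.+ 1ℚ) (ℚ.+-identityʳ _) (ℚ.+-monoʳ-< ∣ p ∣ (ℚ.positive⁻¹ 1ℚ)))

    module _ (B : ℚ) (0<B : 0ℚ ℚ.< B) where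
      instance
        B-pos : ℚ.Positive B
        B-pos = ℚ.positive 0<B
        B-nonZero : ℚ.NonZero B
        B-nonZero = ℚ.pos⇒nonZero B

      B⁻¹ : ℚ
      B⁻¹ = ℚ.1/ B

      0<B⁻¹ : 0ℚ ℚ.< B⁻¹
      0<B⁻¹ = ℚ.positive⁻¹ _ {{ℚ.1/pos⇒pos B}}

      B*[B⁻¹*ε] : ∀ ε → B ℚ.* (B⁻¹ ℚ.* ε) ≡ ε
      B*[B⁻¹*ε] ε = ≡.trans (≡.sym (ℚ.*-assoc B B⁻¹ ε)) (≡.trans (≡.cong (ℚ._* ε) (ℚ.*-inverseʳ B)) (ℚ.*-identityˡ ε))

      bounded-< : ∀ {p q ε} → ∣ p ∣ ℚ.≤ B → ∣ q ∣ ℚ.< B⁻¹ ℚ.* ε → ∣ p ℚ.* q ∣ ℚ.< ε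
      bounded-< {p} {q} {ε} p≤ q< = ≡.subst₂ ℚ._<_ (≡.sym (ℚ.∣p*q∣≡∣p∣*∣q∣ p q)) (B*[B⁻¹*ε] ε)
        (ℚ.≤-<-trans (*-mono-≤ (ℚ.0≤∣p∣ p) (ℚ.0≤∣p∣ q) p≤ ℚ.≤-refl) (ℚ.*-monoʳ-<-pos B q<))

    abstract
      cauchy-bounded : ∀ s → IsCauchy s → ∃[ B ] 0ℚ ℚ.< B × Eventually (λ n → ∣ s n ∣ ℚ.≤ B)
      cauchy-bounded s c with c 1ℚ (ℚ.positive⁻¹ 1ℚ)
      ... | N , close = ∣ s N ∣ ℚ.+ 1ℚ , 0<a+1 (s N) , N , λ n N≤n →
        ℚ.≤-trans (∣∣-triangle (s n) (s N)) (ℚ.+-monoʳ-≤ ∣ s N ∣ (ℚ.<⇒≤ (close n N N≤n ℕ.≤-refl)))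

      cauchy-+ : ∀ s t → IsCauchy s → IsCauchy t → IsCauchy (λ n → s n ℚ.+ t n)
      cauchy-+ s t c d ε 0<ε with c (half ε) (half-pos 0<ε) | d (half ε) (half-pos 0<ε)
      ... | M , p | N , q = M ℕ.⊔ N , λ m n ≤m ≤n →
        ℚ.≤-<-trans (bound m n)
          (+-halves ε (p m n (ℕ.≤-trans (ℕ.m≤m⊔n M N) ≤m) (ℕ.≤-trans (ℕ.m≤m⊔n M N) ≤n))
                      (q m n (ℕ.≤-trans (ℕ.m≤n⊔m M N) ≤m) (ℕ.≤-trans (ℕ.m≤n⊔m M N) ≤n)))
        where
        bound : ∀ m n → ∣ (s m ℚ.+ t m) ℚ.- (s n ℚ.+ t n) ∣ ℚ.≤ ∣ s m ℚ.- s n ∣ ℚ.+ ∣ t m ℚ.- t n ∣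
        bound m n = ≡.subst (λ u → ∣ u ∣ ℚ.≤ ∣ s m ℚ.- s n ∣ ℚ.+ ∣ t m ℚ.- t n ∣)
          (solve 4 (λ a b c d → (a :- c) :+ (b :- d) := (a :+ b) :- (c :+ d)) ≡.refl (s m) (t m) (s n) (t n))
          (ℚ.∣p+q∣≤∣p∣+∣q∣ (s m ℚ.- s n) (t m ℚ.- t n))

      cauchy-neg : ∀ s → IsCauchy s → IsCauchy (λ n → ℚ.- s n)
      cauchy-neg s c ε 0<ε with c ε 0<ε
      ... | N , p = N , λ m n ≤m ≤n → ≡.subst (ℚ._< ε) (flip (s m) (s n)) (p m n ≤m ≤n)
        where
        flip : ∀ a b → ∣ a ℚ.- b ∣ ≡ ∣ ℚ.- a ℚ.- ℚ.- b ∣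
        flip a b = ≡.trans (∣-∣-sym a b) (≡.cong ∣_∣ (solve 2 (λ a b → b :- a := (:- a) :- (:- b)) ≡.refl a b))

      cauchy-- : ∀ s t → IsCauchy s → IsCauchy t → IsCauchy (λ n → s n ℚ.- t n)
      cauchy-- s t c d = cauchy-+ s (λ n → ℚ.- t n) c (cauchy-neg t d)

    -- Holds by refl, but ℚ's operations unfold on open terms, so letting the
    -- conversion checker find it inside larger expressions is too expensive.
    -≡+- : ∀ p q → p ℚ.- q ≡ p ℚ.+ ℚ.- q
    -≡+- p q = ≡.refl

    *-diff : ∀ a b c d → ∣ a ℚ.* b ℚ.- c ℚ.* d ∣ ℚ.≤ ∣ a ℚ.* (b ℚ.- d) ∣ ℚ.+ ∣ d ℚ.* (a ℚ.- c) ∣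
    *-diff a b c d = ≡.subst (λ u → ∣ u ∣ ℚ.≤ ∣ a ℚ.* (b ℚ.- d) ∣ ℚ.+ ∣ d ℚ.* (a ℚ.- c) ∣)
      (solve 4 (λ a b c d → a :* (b :- d) :+ d :* (a :- c) := a :* b :- c :* d) ≡.refl a b c d)
      (ℚ.∣p+q∣≤∣p∣+∣q∣ (a ℚ.* (b ℚ.- d)) (d ℚ.* (a ℚ.- c)))

    abstract
      cauchy-* : ∀ s t → IsCauchy s → IsCauchy t → IsCauchy (λ n → s n ℚ.* t n)
      cauchy-* s t c d ε 0<ε =
        let (A , 0<A , s≤A) = cauchy-bounded s c
            (B , 0<B , t≤B) = cauchy-bounded t d
            (M , p) = c (B⁻¹ B 0<B ℚ.* half ε) (*-pos (0<B⁻¹ B 0<B) (half-pos 0<ε))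
            (N , q) = d (B⁻¹ A 0<A ℚ.* half ε) (*-pos (0<B⁻¹ A 0<A) (half-pos 0<ε))
            (L , st≤) = both s≤A t≤B
            M≤ : ∀ {k} → M ℕ.⊔ N ℕ.⊔ L ℕ.≤ k → M ℕ.≤ k
            M≤ ≤k = ℕ.≤-trans (ℕ.m≤m⊔n M N) (ℕ.≤-trans (ℕ.m≤m⊔n (M ℕ.⊔ N) L) ≤k)
            N≤ : ∀ {k} → M ℕ.⊔ N ℕ.⊔ L ℕ.≤ k → N ℕ.≤ k
            N≤ ≤k = ℕ.≤-trans (ℕ.m≤n⊔m M N) (ℕ.≤-trans (ℕ.m≤m⊔n (M ℕ.⊔ N) L) ≤k)
            L≤ : ∀ {k} → M ℕ.⊔ N ℕ.⊔ L ℕ.≤ k → L ℕ.≤ k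
            L≤ ≤k = ℕ.≤-trans (ℕ.m≤n⊔m (M ℕ.⊔ N) L) ≤k
        in M ℕ.⊔ N ℕ.⊔ L , λ m n ≤m ≤n →
          ℚ.≤-<-trans (*-diff (s m) (t m) (s n) (t n))
            (+-halves ε
              (bounded-< A 0<A {s m} {t m ℚ.- t n} (proj₁ (st≤ m (L≤ ≤m))) (q m n (N≤ ≤m) (N≤ ≤n)))
              (bounded-< B 0<B {t n} {s m ℚ.- s n} (proj₂ (st≤ n (L≤ ≤n))) (p m n (M≤ ≤m) (M≤ ≤n))))

  infixl 6 _+ᴿ_ _-ᴿ_
  infixl 7 _*ᴿ_
  infix  8 -ᴿ_

  -- Opaque only so that equations over ℝ do not unfold into ℚ-arithmetic.
  opaque
    _+ᴿ_ : ℝ → ℝ → ℝ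
    x +ᴿ y = real (λ n → seq x n ℚ.+ seq y n) (cauchy-+ (seq x) (seq y) (cauchy x) (cauchy y))

    _*ᴿ_ : ℝ → ℝ → ℝ
    x *ᴿ y = real (λ n → seq x n ℚ.* seq y n) (cauchy-* (seq x) (seq y) (cauchy x) (cauchy y))

    -ᴿ_ : ℝ → ℝ
    -ᴿ x = real (λ n → ℚ.- seq x n) (cauchy-neg (seq x) (cauchy x))

  _-ᴿ_ : ℝ → ℝ → ℝ
  x -ᴿ y = x +ᴿ (-ᴿ y)

  fromℚ : ℚ → ℝ
  fromℚ q = real (λ _ → q) (λ ε 0<ε → 0 , λ _ _ _ _ → ∣x-x∣<ε q 0<ε)

  0ᴿ 1ᴿ : ℝ
  0ᴿ = fromℚ 0ℚ
  1ᴿ = fromℚ 1ℚ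

  pointwise : ∀ {x y} → (∀ n → seq x n ≡ seq y n) → x ≈ᴿ y
  pointwise {x} {y} eq = mk≈ λ ε 0<ε → 0 , λ n _ →
    ≡.subst (λ t → ∣ seq x n ℚ.- t ∣ ℚ.< ε) (eq n) (∣x-x∣<ε (seq x n) 0<ε)

  ≈ᴿ-sym : ∀ {x y} → x ≈ᴿ y → y ≈ᴿ x
  ≈ᴿ-sym {x} {y} (mk≈ p) = mk≈ λ ε 0<ε →
    map (λ n → ≡.subst (ℚ._< ε) (∣-∣-sym (seq x n) (seq y n))) (p ε 0<ε)

  ≈ᴿ-trans : ∀ {x y z} → x ≈ᴿ y → y ≈ᴿ z → x ≈ᴿ z
  ≈ᴿ-trans {x} {y} {z} (mk≈ p) (mk≈ q) = mk≈ λ ε 0<ε →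
    map (λ n (a , b) → ℚ.≤-<-trans (triangle (seq x n) (seq y n) (seq z n)) (+-halves ε a b))
        (both (p (half ε) (half-pos 0<ε)) (q (half ε) (half-pos 0<ε)))

  opaque
    unfolding _+ᴿ_ _*ᴿ_ -ᴿ_

    +ᴿ-cong : ∀ {x x′ y y′} → x ≈ᴿ x′ → y ≈ᴿ y′ → x +ᴿ y ≈ᴿ x′ +ᴿ y′
    +ᴿ-cong {x} {x′} {y} {y′} (mk≈ p) (mk≈ q) = mk≈ λ ε 0<ε →
      map (λ n (a , b) → ℚ.≤-<-trans (bound (seq x n) (seq x′ n) (seq y n) (seq y′ n)) (+-halves ε a b))
          (both (p (half ε) (half-pos 0<ε)) (q (half ε) (half-pos 0<ε)))
      where
      bound : ∀ a a′ b b′ → ∣ (a ℚ.+ b) ℚ.- (a′ ℚ.+ b′) ∣ ℚ.≤ ∣ a ℚ.- a′ ∣ ℚ.+ ∣ b ℚ.- b′ ∣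
      bound a a′ b b′ = ≡.subst (λ u → ∣ u ∣ ℚ.≤ ∣ a ℚ.- a′ ∣ ℚ.+ ∣ b ℚ.- b′ ∣)
        (solve 4 (λ a a′ b b′ → (a :- a′) :+ (b :- b′) := (a :+ b) :- (a′ :+ b′)) ≡.refl a a′ b b′)
        (ℚ.∣p+q∣≤∣p∣+∣q∣ (a ℚ.- a′) (b ℚ.- b′))

    -ᴿ-cong : ∀ {x y} → x ≈ᴿ y → -ᴿ x ≈ᴿ -ᴿ y
    -ᴿ-cong {x} {y} (mk≈ p) = mk≈ λ ε 0<ε →
      map (λ n → ≡.subst (ℚ._< ε) (≡.trans (∣-∣-sym (seq x n) (seq y n))
            (≡.cong ∣_∣ (solve 2 (λ a b → b :- a := (:- a) :- (:- b)) ≡.refl (seq x n) (seq y n))))) (p ε 0<ε)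

    *ᴿ-cong : ∀ {x x′ y y′} → x ≈ᴿ x′ → y ≈ᴿ y′ → x *ᴿ y ≈ᴿ x′ *ᴿ y′
    *ᴿ-cong {x} {x′} {y} {y′} (mk≈ p) (mk≈ q) =
      helper (cauchy-bounded (seq x) (cauchy x)) (cauchy-bounded (seq y′) (cauchy y′))
      where
      helper : ∃[ A ] 0ℚ ℚ.< A × Eventually (λ n → ∣ seq x n ∣ ℚ.≤ A) →
               ∃[ B ] 0ℚ ℚ.< B × Eventually (λ n → ∣ seq y′ n ∣ ℚ.≤ B) →
               x *ᴿ y ≈ᴿ x′ *ᴿ y′
      helper (A , 0<A , x≤A) (B , 0<B , y′≤B) = mk≈ λ ε 0<ε →
        map (λ n ((x≤ , y≤) , a , b) →
              ℚ.≤-<-trans (*-diff (seq x n) (seq y n) (seq x′ n) (seq y′ n))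
                (+-halves ε (bounded-< A 0<A {seq x n} {seq y n ℚ.- seq y′ n} x≤ b)
                            (bounded-< B 0<B {seq y′ n} {seq x n ℚ.- seq x′ n} y≤ a)))
            (both (both x≤A y′≤B)
                  (both (p (B⁻¹ B 0<B ℚ.* half ε) (*-pos (0<B⁻¹ B 0<B) (half-pos 0<ε)))
                        (q (B⁻¹ A 0<A ℚ.* half ε) (*-pos (0<B⁻¹ A 0<A) (half-pos 0<ε)))))

    +ᴿ-assoc : ∀ x y z → (x +ᴿ y) +ᴿ z ≈ᴿ x +ᴿ (y +ᴿ z)
    +ᴿ-assoc x y z = pointwise λ n → ℚ.+-assoc (seq x n) (seq y n) (seq z n)

    +ᴿ-comm : ∀ x y → x +ᴿ y ≈ᴿ y +ᴿ x
    +ᴿ-comm x y = pointwise λ n → ℚ.+-comm (seq x n) (seq y n)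

    +ᴿ-identityˡ : ∀ x → 0ᴿ +ᴿ x ≈ᴿ x
    +ᴿ-identityˡ x = pointwise λ n → ℚ.+-identityˡ (seq x n)

    -ᴿ-inverseʳ : ∀ x → x +ᴿ -ᴿ x ≈ᴿ 0ᴿ
    -ᴿ-inverseʳ x = pointwise λ n → ℚ.+-inverseʳ (seq x n)

    *ᴿ-assoc : ∀ x y z → (x *ᴿ y) *ᴿ z ≈ᴿ x *ᴿ (y *ᴿ z)
    *ᴿ-assoc x y z = pointwise λ n → ℚ.*-assoc (seq x n) (seq y n) (seq z n)

    *ᴿ-comm : ∀ x y → x *ᴿ y ≈ᴿ y *ᴿ x
    *ᴿ-comm x y = pointwise λ n → ℚ.*-comm (seq x n) (seq y n)

    *ᴿ-identityˡ : ∀ x → 1ᴿ *ᴿ x ≈ᴿ x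
    *ᴿ-identityˡ x = pointwise λ n → ℚ.*-identityˡ (seq x n)

    *ᴿ-distribʳ-+ᴿ : ∀ x y z → (y +ᴿ z) *ᴿ x ≈ᴿ y *ᴿ x +ᴿ z *ᴿ x
    *ᴿ-distribʳ-+ᴿ x y z = pointwise λ n → ℚ.*-distribʳ-+ (seq x n) (seq y n) (seq z n)

  abstract
    ℝ-isCommutativeRing : IsCommutativeRing _≈ᴿ_ _+ᴿ_ _*ᴿ_ -ᴿ_ 0ᴿ 1ᴿ
    ℝ-isCommutativeRing = record
      { isRing = record
        { +-isAbelianGroup = record
          { isGroup = record
            { isMonoid = record
              { isSemigroup = record
                { isMagma = record
                  { isEquivalence = record { refl = pointwise λ _ → ≡.refl ; sym = ≈ᴿ-sym ; trans = ≈ᴿ-trans }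
                  ; ∙-cong = +ᴿ-cong
                  }
                ; assoc = +ᴿ-assoc
                }
              ; identity = +ᴿ-identityˡ , λ x → ≈ᴿ-trans (+ᴿ-comm x 0ᴿ) (+ᴿ-identityˡ x)
              }
            ; inverse = (λ x → ≈ᴿ-trans (+ᴿ-comm (-ᴿ x) x) (-ᴿ-inverseʳ x)) , -ᴿ-inverseʳ
            ; ⁻¹-cong = -ᴿ-cong
            }
          ; comm = +ᴿ-comm
          }
        ; *-cong = *ᴿ-cong
        ; *-assoc = *ᴿ-assoc
        ; *-identity = *ᴿ-identityˡ , λ x → ≈ᴿ-trans (*ᴿ-comm x 1ᴿ) (*ᴿ-identityˡ x)
        ; distrib = (λ x y z → ≈ᴿ-trans (*ᴿ-comm x (y +ᴿ z))
                      (≈ᴿ-trans (*ᴿ-distribʳ-+ᴿ x y z) (+ᴿ-cong (*ᴿ-comm y x) (*ᴿ-comm z x))))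
                  , *ᴿ-distribʳ-+ᴿ
        }
      ; *-comm = *ᴿ-comm
      }

  ℝ-commutativeRing : CommutativeRing 0ℓ 0ℓ
  ℝ-commutativeRing = record
    { Carrier = ℝ
    ; _≈_ = _≈ᴿ_
    ; _+_ = _+ᴿ_
    ; _*_ = _*ᴿ_
    ; -_ = -ᴿ_
    ; 0# = 0ᴿ
    ; 1# = 1ᴿ
    ; isCommutativeRing = ℝ-isCommutativeRing
    }

  abstract
    #ᴿ-sym : ∀ {x y} → x #ᴿ y → y #ᴿ x
    #ᴿ-sym {x} {y} (mk# ε 0<ε p) = mk# ε 0<ε (map (λ n → ≡.subst (ε ℚ.≤_) (∣-∣-sym (seq x n) (seq y n))) p)

    ≈ᴿ⇒¬#ᴿ : ∀ {x y} → x ≈ᴿ y → ¬ x #ᴿ y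
    ≈ᴿ⇒¬#ᴿ (mk≈ p) (mk# ε 0<ε q) with both (p ε 0<ε) q
    ... | N , r = ℚ.<-irrefl ≡.refl (ℚ.<-≤-trans (proj₁ (r N ℕ.≤-refl)) (proj₂ (r N ℕ.≤-refl)))

    close⊎apart : ∀ x y ε → 0ℚ ℚ.< ε → Eventually (λ n → ∣ seq x n ℚ.- seq y n ∣ ℚ.< ε) ⊎ x #ᴿ y
    close⊎apart x y ε 0<ε = helper (cauchy-- (seq x) (seq y) (cauchy x) (cauchy y) q 0<q)
      where
      d : ℕ → ℚ
      d n = seq x n ℚ.- seq y n

      q : ℚ
      q = half (half ε)

      0<q : 0ℚ ℚ.< q
      0<q = half-pos (half-pos 0<ε)

      q<½ε : q ℚ.< half ε
      q<½ε = ≡.subst₂ ℚ._<_ (ℚ.+-identityʳ q) (half+half (half ε)) (ℚ.+-monoʳ-< q 0<q)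

      helper : ∃[ N ] (∀ m n → N ℕ.≤ m → N ℕ.≤ n → ∣ d m ℚ.- d n ∣ ℚ.< q) →
               Eventually (λ n → ∣ d n ∣ ℚ.< ε) ⊎ x #ᴿ y
      helper (N , p) with ∣ d N ∣ ℚ.<? half ε
      ... | yes small = inj₁ (N , λ n N≤n →
        ℚ.≤-<-trans (∣∣-triangle (d n) (d N)) (+-halves ε small (ℚ.<-trans (p n N N≤n ℕ.≤-refl) q<½ε)))
      ... | no large = inj₂ (mk# q 0<q (N , λ n N≤n →
        ≡.subst (ℚ._≤ ∣ d n ∣) (solve 1 (λ h → h :- con ½ :* h := con ½ :* h) ≡.refl (half ε))
          (p≤q+r⇒p-r≤q {half ε} {∣ d n ∣} {q} (ℚ.≤-trans (ℚ.≮⇒≥ large) (ℚ.≤-trans (∣∣-triangle (d N) (d n))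
            (ℚ.+-monoʳ-≤ ∣ d n ∣ (ℚ.<⇒≤ (p N n ℕ.≤-refl N≤n))))))))

    ¬#ᴿ⇒≈ᴿ : ∀ {x y} → ¬ x #ᴿ y → x ≈ᴿ y
    ¬#ᴿ⇒≈ᴿ {x} {y} ¬x#y = mk≈ λ ε 0<ε → [ id , (λ x#y → ⊥-elim (¬x#y x#y)) ]′ (close⊎apart x y ε 0<ε)

    #ᴿ-cotrans : ∀ {x y} → x #ᴿ y → ∀ z → x #ᴿ z ⊎ z #ᴿ y
    #ᴿ-cotrans {x} {y} (mk# ε 0<ε p) z =
      [ (λ close → inj₂ (mk# (half ε) (half-pos 0<ε)
          (map (λ n (far , near) → bound (seq x n) (seq y n) (seq z n) far near) (both p close))))
      , inj₁ ]′ (close⊎apart x z (half ε) (half-pos 0<ε))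
      where
      open ℚ.≤-Reasoning
      bound : ∀ a b c → ε ℚ.≤ ∣ a ℚ.- b ∣ → ∣ a ℚ.- c ∣ ℚ.< half ε → half ε ℚ.≤ ∣ c ℚ.- b ∣
      bound a b c far near = ≡.subst (ℚ._≤ ∣ c ℚ.- b ∣)
        (solve 1 (λ e → e :- con ½ :* e := con ½ :* e) ≡.refl ε)
        (p≤q+r⇒p-r≤q {ε} {∣ c ℚ.- b ∣} {half ε} (begin
          ε                                  ≤⟨ far ⟩
          ∣ a ℚ.- b ∣                        ≤⟨ triangle a c b ⟩
          ∣ a ℚ.- c ∣ ℚ.+ ∣ c ℚ.- b ∣        ≡⟨ ℚ.+-comm ∣ a ℚ.- c ∣ ∣ c ℚ.- b ∣ ⟩
          ∣ c ℚ.- b ∣ ℚ.+ ∣ a ℚ.- c ∣        ≤⟨ ℚ.+-monoʳ-≤ ∣ c ℚ.- b ∣ (ℚ.<⇒≤ near) ⟩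
          ∣ c ℚ.- b ∣ ℚ.+ half ε             ∎))

  private
    recip : ℚ → ℚ
    recip q with q ℚ.≟ 0ℚ
    ... | yes _  = 0ℚ
    ... | no q≢0 = ℚ.1/_ q {{ℚ.≢-nonZero q≢0}}

    recip-inverse : ∀ q {ε} → 0ℚ ℚ.< ε → ε ℚ.≤ ∣ q ∣ → q ℚ.* recip q ≡ 1ℚ
    recip-inverse q {ε} 0<ε ε≤∣q∣ with q ℚ.≟ 0ℚ
    ... | yes ≡.refl = ⊥-elim (ℚ.<-irrefl ≡.refl (ℚ.<-≤-trans 0<ε ε≤∣q∣))
    ... | no q≢0     = ℚ.*-inverseʳ q {{ℚ.≢-nonZero q≢0}}

    recip-bound : ∀ q {ε} (0<ε : 0ℚ ℚ.< ε) → ε ℚ.≤ ∣ q ∣ → ∣ recip q ∣ ℚ.≤ B⁻¹ ε 0<ε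
    recip-bound q {ε} 0<ε ε≤∣q∣ = ℚ.*-cancelˡ-≤-pos ε {{ℚ.positive 0<ε}} (begin
      ε ℚ.* ∣ recip q ∣      ≤⟨ ℚ.*-monoʳ-≤-nonNeg ∣ recip q ∣ {{ℚ.∣-∣-nonNeg (recip q)}} ε≤∣q∣ ⟩
      ∣ q ∣ ℚ.* ∣ recip q ∣  ≡⟨ ℚ.∣p*q∣≡∣p∣*∣q∣ q (recip q) ⟨
      ∣ q ℚ.* recip q ∣      ≡⟨ ≡.cong ∣_∣ (recip-inverse q 0<ε ε≤∣q∣) ⟩
      1ℚ                     ≡⟨ ℚ.*-inverseʳ ε {{B-nonZero ε 0<ε}} ⟨
      ε ℚ.* B⁻¹ ε 0<ε        ∎)
      where open ℚ.≤-Reasoning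

    recip-diff : ∀ p q → p ℚ.* recip p ≡ 1ℚ → q ℚ.* recip q ≡ 1ℚ →
                 recip p ℚ.- recip q ≡ recip p ℚ.* (recip q ℚ.* (q ℚ.- p))
    recip-diff p q pp′≡1 qq′≡1 = begin
      p′ ℚ.- q′                                    ≡⟨ solve 2 (λ p′ q′ → p′ :- q′ := p′ :* con 1ℚ :- q′ :* con 1ℚ) ≡.refl p′ q′ ⟩
      p′ ℚ.* 1ℚ ℚ.- q′ ℚ.* 1ℚ                      ≡⟨ ≡.cong₂ (λ u v → p′ ℚ.* u ℚ.- q′ ℚ.* v) qq′≡1 pp′≡1 ⟨
      p′ ℚ.* (q ℚ.* q′) ℚ.- q′ ℚ.* (p ℚ.* p′)      ≡⟨ solve 4 (λ p q p′ q′ → p′ :* (q :* q′) :- q′ :* (p :* p′) := p′ :* (q′ :* (q :- p))) ≡.refl p q p′ q′ ⟩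
      p′ ℚ.* (q′ ℚ.* (q ℚ.- p))                    ∎
      where
      open ≡.≡-Reasoning
      p′ = recip p
      q′ = recip q

    cauchy-recip : ∀ s → IsCauchy s → ∀ δ → 0ℚ ℚ.< δ → Eventually (λ n → δ ℚ.≤ ∣ s n ∣) → IsCauchy (λ n → recip (s n))
    cauchy-recip s c δ 0<δ (M , far) ε 0<ε =
      let D = B⁻¹ δ 0<δ
          0<D = 0<B⁻¹ δ 0<δ
          (N , p) = c (B⁻¹ D 0<D ℚ.* (B⁻¹ D 0<D ℚ.* ε)) (*-pos (0<B⁻¹ D 0<D) (*-pos (0<B⁻¹ D 0<D) 0<ε))
      in M ℕ.⊔ N , λ m n ≤m ≤n →
        let farₘ = far m (ℕ.≤-trans (ℕ.m≤m⊔n M N) ≤m)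
            farₙ = far n (ℕ.≤-trans (ℕ.m≤m⊔n M N) ≤n)
        in ≡.subst (λ t → ∣ t ∣ ℚ.< ε)
             (≡.sym (recip-diff (s m) (s n) (recip-inverse (s m) 0<δ farₘ) (recip-inverse (s n) 0<δ farₙ)))
             (bounded-< D 0<D {recip (s m)} {recip (s n) ℚ.* (s n ℚ.- s m)} (recip-bound (s m) 0<δ farₘ)
               (bounded-< D 0<D {recip (s n)} {s n ℚ.- s m} (recip-bound (s n) 0<δ farₙ)
                 (p n m (ℕ.≤-trans (ℕ.m≤n⊔m M N) ≤n) (ℕ.≤-trans (ℕ.m≤n⊔m M N) ≤m))))

  open Algebra.Definitions _≈ᴿ_ using () renaming (Invertible to Invertibleᴿ)

  opaque
    unfolding _+ᴿ_ _*ᴿ_ -ᴿ_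

    #ᴿ⇒invertible : ∀ {x y} → x #ᴿ y → Invertibleᴿ 1ᴿ _*ᴿ_ (x -ᴿ y)
    #ᴿ⇒invertible {x} {y} (mk# ε 0<ε away) = d⁻¹ , ≈ᴿ-trans (*-comm d⁻¹ d) dd⁻¹≈1 , dd⁻¹≈1
      where
      open CommutativeRing ℝ-commutativeRing using (*-comm)

      far : Eventually (λ n → ε ℚ.≤ ∣ seq x n ℚ.+ ℚ.- seq y n ∣)
      far = map (λ n → ≡.subst (λ t → ε ℚ.≤ ∣ t ∣) (-≡+- (seq x n) (seq y n))) away

      d d⁻¹ : ℝ
      d = x -ᴿ y
      d⁻¹ = real (λ n → recip (seq x n ℚ.+ ℚ.- seq y n)) (cauchy-recip (seq d) (cauchy d) ε 0<ε far)

      dd⁻¹≈1 : d *ᴿ d⁻¹ ≈ᴿ 1ᴿ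
      dd⁻¹≈1 = mk≈ λ δ 0<δ → map (λ n ε≤ → ≡.subst (λ t → ∣ t ℚ.- 1ℚ ∣ ℚ.< δ)
        (≡.sym (recip-inverse (seq x n ℚ.+ ℚ.- seq y n) 0<ε ε≤)) (∣x-x∣<ε 1ℚ 0<δ)) far

    invertible⇒#ᴿ : ∀ {x y} → Invertibleᴿ 1ᴿ _*ᴿ_ (x -ᴿ y) → x #ᴿ y
    invertible⇒#ᴿ {x} {y} (z , _ , mk≈ dz≈1) = helper (cauchy-bounded (seq z) (cauchy z))
      where
      open ℚ.≤-Reasoning
      d : ℕ → ℚ
      d n = seq x n ℚ.+ ℚ.- seq y n

      bound : ∀ B (0<B : 0ℚ ℚ.< B) n → ∣ seq z n ∣ ℚ.≤ B → ∣ d n ℚ.* seq z n ℚ.- 1ℚ ∣ ℚ.< ½ → B⁻¹ B 0<B ℚ.* ½ ℚ.≤ ∣ d n ∣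
      bound B 0<B n z≤ near = ℚ.*-cancelˡ-≤-pos B {{ℚ.positive 0<B}} (begin
        B ℚ.* (B⁻¹ B 0<B ℚ.* ½)      ≡⟨ B*[B⁻¹*ε] B 0<B ½ ⟩
        1ℚ ℚ.- ½                     ≤⟨ p≤q+r⇒p-r≤q {1ℚ} {∣ d n ℚ.* seq z n ∣} {½} (begin
          1ℚ                                                          ≤⟨ ∣∣-triangle 1ℚ (d n ℚ.* seq z n) ⟩
          ∣ d n ℚ.* seq z n ∣ ℚ.+ ∣ 1ℚ ℚ.- d n ℚ.* seq z n ∣          ≡⟨ ≡.cong (∣ d n ℚ.* seq z n ∣ ℚ.+_) (∣-∣-sym 1ℚ (d n ℚ.* seq z n)) ⟩
          ∣ d n ℚ.* seq z n ∣ ℚ.+ ∣ d n ℚ.* seq z n ℚ.- 1ℚ ∣          ≤⟨ ℚ.+-monoʳ-≤ ∣ d n ℚ.* seq z n ∣ (ℚ.<⇒≤ near) ⟩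
          ∣ d n ℚ.* seq z n ∣ ℚ.+ ½                                   ∎) ⟩
        ∣ d n ℚ.* seq z n ∣          ≡⟨ ℚ.∣p*q∣≡∣p∣*∣q∣ (d n) (seq z n) ⟩
        ∣ d n ∣ ℚ.* ∣ seq z n ∣      ≤⟨ ℚ.*-monoˡ-≤-nonNeg ∣ d n ∣ {{ℚ.∣-∣-nonNeg (d n)}} z≤ ⟩
        ∣ d n ∣ ℚ.* B                ≡⟨ ℚ.*-comm ∣ d n ∣ B ⟩
        B ℚ.* ∣ d n ∣                ∎)

      helper : ∃[ B ] 0ℚ ℚ.< B × Eventually (λ n → ∣ seq z n ∣ ℚ.≤ B) → x #ᴿ y
      helper (B , 0<B , z≤B) = mk# (B⁻¹ B 0<B ℚ.* ½) (*-pos (0<B⁻¹ B 0<B) 0<½)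
        (map (λ n (z≤ , near) → ≡.subst (λ t → B⁻¹ B 0<B ℚ.* ½ ℚ.≤ ∣ t ∣) (≡.sym (-≡+- (seq x n) (seq y n))) (bound B 0<B n z≤ near))
             (both z≤B (dz≈1 ½ 0<½)))

  ℝ-heytingField : HeytingField 0ℓ 0ℓ 0ℓ
  ℝ-heytingField = record
    { _#_ = _#ᴿ_
    ; isHeytingField = record
      { isHeytingCommutativeRing = record
        { isCommutativeRing = ℝ-isCommutativeRing
        ; isApartnessRelation = record { irrefl = ≈ᴿ⇒¬#ᴿ ; sym = #ᴿ-sym ; cotrans = #ᴿ-cotrans }
        ; #⇒invertible = #ᴿ⇒invertible
        ; invertible⇒# = invertible⇒#ᴿ
        }
      ; tight = λ x y → ¬#ᴿ⇒≈ᴿ , ≈ᴿ⇒¬#ᴿ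
      }
    }

  opaque
    unfolding _+ᴿ_ _*ᴿ_

    sum-of-squares-#0 : ∀ {x y} → x #ᴿ 0ᴿ ⊎ y #ᴿ 0ᴿ → x *ᴿ x +ᴿ y *ᴿ y #ᴿ 0ᴿ
    sum-of-squares-#0 {x} {y} = [ (λ (mk# ε 0<ε (N , far)) → mk# (ε ℚ.* ε) (*-pos′ 0<ε) (N , λ n N≤n → bound (seq x n) (seq y n) 0<ε (far n N≤n)))
                                , (λ (mk# ε 0<ε (N , far)) → mk# (ε ℚ.* ε) (*-pos′ 0<ε) (N , λ n N≤n →
                                      ≡.subst (λ t → ε ℚ.* ε ℚ.≤ ∣ t ℚ.- 0ℚ ∣) (ℚ.+-comm (seq y n ℚ.* seq y n) (seq x n ℚ.* seq x n))
                                        (bound (seq y n) (seq x n) 0<ε (far n N≤n)))) ]′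
      where
      open ℚ.≤-Reasoning

      *-pos′ : ∀ {ε} → 0ℚ ℚ.< ε → 0ℚ ℚ.< ε ℚ.* ε
      *-pos′ {ε} 0<ε = ℚ.positive⁻¹ _ {{ℚ.pos*pos⇒pos ε {{ℚ.positive 0<ε}} ε {{ℚ.positive 0<ε}}}}

      square : ∀ p → p ℚ.* p ≡ ∣ p ∣ ℚ.* ∣ p ∣
      square p = [ (λ eq → ≡.cong (λ t → t ℚ.* t) (≡.sym eq))
                 , (λ eq → ≡.trans (solve 1 (λ p → p :* p := (:- p) :* (:- p)) ≡.refl p) (≡.cong (λ t → t ℚ.* t) (≡.sym eq)))
                 ]′ (ℚ.∣p∣≡p∨∣p∣≡-p p)
  
      0≤square : ∀ p → 0ℚ ℚ.≤ p ℚ.* p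
      0≤square p = ≡.subst (0ℚ ℚ.≤_) (≡.sym (square p))
        (ℚ.nonNegative⁻¹ _ {{ℚ.nonNeg*nonNeg⇒nonNeg (∣ p ∣) {{ℚ.∣-∣-nonNeg p}} (∣ p ∣) {{ℚ.∣-∣-nonNeg p}}}})

      bound : ∀ p q {ε} → 0ℚ ℚ.< ε → ε ℚ.≤ ∣ p ℚ.- 0ℚ ∣ → ε ℚ.* ε ℚ.≤ ∣ (p ℚ.* p ℚ.+ q ℚ.* q) ℚ.- 0ℚ ∣
      bound p q {ε} 0<ε far = begin
        ε ℚ.* ε                                ≤⟨ ℚ.*-monoˡ-≤-nonNeg ε {{ℚ.pos⇒nonNeg ε {{ℚ.positive 0<ε}}}} ε≤∣p∣ ⟩
        ε ℚ.* ∣ p ∣                            ≤⟨ ℚ.*-monoʳ-≤-nonNeg ∣ p ∣ {{ℚ.∣-∣-nonNeg p}} ε≤∣p∣ ⟩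
        ∣ p ∣ ℚ.* ∣ p ∣                        ≡⟨ square p ⟨
        p ℚ.* p                                ≡⟨ ℚ.+-identityʳ (p ℚ.* p) ⟨
        p ℚ.* p ℚ.+ 0ℚ                         ≤⟨ ℚ.+-monoʳ-≤ (p ℚ.* p) (0≤square q) ⟩
        p ℚ.* p ℚ.+ q ℚ.* q                    ≡⟨ ℚ.0≤p⇒∣p∣≡p 0≤sum ⟨
        ∣ p ℚ.* p ℚ.+ q ℚ.* q ∣                ≡⟨ ≡.cong ∣_∣ (ℚ.+-identityʳ (p ℚ.* p ℚ.+ q ℚ.* q)) ⟨
        ∣ (p ℚ.* p ℚ.+ q ℚ.* q) ℚ.- 0ℚ ∣       ∎
        where
        ε≤∣p∣ : ε ℚ.≤ ∣ p ∣
        ε≤∣p∣ = ≡.subst (λ t → ε ℚ.≤ ∣ t ∣) (ℚ.+-identityʳ p) far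
        0≤sum : 0ℚ ℚ.≤ p ℚ.* p ℚ.+ q ℚ.* q
        0≤sum = ≡.subst (ℚ._≤ p ℚ.* p ℚ.+ q ℚ.* q) (ℚ.+-identityʳ 0ℚ) (ℚ.+-mono-≤ (0≤square p) (0≤square q))

  isqrt : ∀ n → ∃[ a ] a ℕ.* a ℕ.≤ n × n ℕ.< suc a ℕ.* suc a
  isqrt zero = 0 , ℕ.z≤n , ℕ.s≤s ℕ.z≤n
  isqrt (suc n) with isqrt n
  ... | a , a²≤n , n<[1+a]² with suc a ℕ.* suc a ℕ.≤? suc n
  ...   | yes p = suc a , p , ℕ.≤-<-trans n<[1+a]² (ℕ.*-mono-< (ℕ.n<1+n (suc a)) (ℕ.n<1+n (suc a)))
  ...   | no ¬p = a , ℕ.m≤n⇒m≤1+n a²≤n , ℕ.≰⇒> ¬p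

  -- The n-th approximation to √k is ⌊ (n+1)√k ⌋ / (n+1).
  √-seq : ℕ → ℕ → ℚ
  √-seq k n = + proj₁ (isqrt (k ℕ.* (suc n ℕ.* suc n))) ℚ./ suc n

  private
    /-mono-< : ∀ i m j n → i ℤ.* + suc n ℤ.< j ℤ.* + suc m → i ℚ./ suc m ℚ.< j ℚ./ suc n
    /-mono-< i m j n h = ℚ.toℚᵘ-cancel-< (ℚᵘ.<-respˡ-≃ (ℚᵘ.≃-sym (ℚ.toℚᵘ-fromℚᵘ (ℚᵘ.mkℚᵘ i m)))
      (ℚᵘ.<-respʳ-≃ (ℚᵘ.≃-sym (ℚ.toℚᵘ-fromℚᵘ (ℚᵘ.mkℚᵘ j n))) (ℚᵘ.*<* h)))

    /-mono-≤ : ∀ i m j n → i ℤ.* + suc n ℤ.≤ j ℤ.* + suc m → i ℚ./ suc m ℚ.≤ j ℚ./ suc n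
    /-mono-≤ i m j n h = ℚ.toℚᵘ-cancel-≤ (ℚᵘ.≤-respˡ-≃ (ℚᵘ.≃-sym (ℚ.toℚᵘ-fromℚᵘ (ℚᵘ.mkℚᵘ i m)))
      (ℚᵘ.≤-respʳ-≃ (ℚᵘ.≃-sym (ℚ.toℚᵘ-fromℚᵘ (ℚᵘ.mkℚᵘ j n))) (ℚᵘ.*≤* h)))

    +/-distrib : ∀ i j n → (i ℤ.+ j) ℚ./ suc n ≡ i ℚ./ suc n ℚ.+ j ℚ./ suc n
    +/-distrib i j n = ℚ.toℚᵘ-injective (begin
      ℚ.toℚᵘ ((i ℤ.+ j) ℚ./ suc n)                            ≈⟨ ℚ.toℚᵘ-fromℚᵘ (ℚᵘ.mkℚᵘ (i ℤ.+ j) n) ⟩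
      ℚᵘ.mkℚᵘ (i ℤ.+ j) n                                     ≈⟨ common ⟩
      ℚᵘ.mkℚᵘ i n ℚᵘ.+ ℚᵘ.mkℚᵘ j n                            ≈⟨ ℚᵘ.+-cong (ℚ.toℚᵘ-fromℚᵘ (ℚᵘ.mkℚᵘ i n)) (ℚ.toℚᵘ-fromℚᵘ (ℚᵘ.mkℚᵘ j n)) ⟨
      ℚ.toℚᵘ (i ℚ./ suc n) ℚᵘ.+ ℚ.toℚᵘ (j ℚ./ suc n)          ≈⟨ ℚ.toℚᵘ-homo-+ (i ℚ./ suc n) (j ℚ./ suc n) ⟨
      ℚ.toℚᵘ (i ℚ./ suc n ℚ.+ j ℚ./ suc n)                    ∎)
      where
      open Relation.Binary.Reasoning.Setoid ℚᵘ.≃-setoid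
      common : ℚᵘ.mkℚᵘ (i ℤ.+ j) n ℚᵘ.≃ ℚᵘ.mkℚᵘ i n ℚᵘ.+ ℚᵘ.mkℚᵘ j n
      common = ℚᵘ.*≡* (≡.trans (≡.cong ((i ℤ.+ j) ℤ.*_) (ℤ.pos-* (suc n) (suc n)))
        (≡.trans (≡.sym (ℤ.*-assoc (i ℤ.+ j) (+ suc n) (+ suc n)))
          (≡.cong (ℤ._* + suc n) (ℤ.*-distribʳ-+ (+ suc n) i j))))

    √-close : ∀ k m n → √-seq k m ℚ.- √-seq k n ℚ.< + 1 ℚ./ suc n
    √-close k m n with isqrt (k ℕ.* (suc m ℕ.* suc m)) | isqrt (k ℕ.* (suc n ℕ.* suc n))
    ... | a , a²≤ , _ | b , _ , <[1+b]² =
      ≡.subst (+ a ℚ./ suc m ℚ.- + b ℚ./ suc n ℚ.<_)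
        (solve 2 (λ p q → (p :+ q) :- q := p) ≡.refl (+ 1 ℚ./ suc n) (+ b ℚ./ suc n))
        (ℚ.+-monoˡ-< (ℚ.- (+ b ℚ./ suc n))
          (≡.subst (+ a ℚ./ suc m ℚ.<_) (+/-distrib (+ 1) (+ b) n)
            (/-mono-< (+ a) m (+ suc b) n
              (≡.subst₂ ℤ._<_ (ℤ.pos-* a (suc n)) (ℤ.pos-* (suc b) (suc m)) (ℤ.+<+ cross)))))
      where
      square-*  : ∀ x y → (x ℕ.* y) ℕ.* (x ℕ.* y) ≡ (x ℕ.* x) ℕ.* (y ℕ.* y)
      square-* x y = ℕ.[m*n]*[o*p]≡[m*o]*[n*p] x y x y
      sq : a ℕ.* suc n ℕ.* (a ℕ.* suc n) ℕ.< suc b ℕ.* suc m ℕ.* (suc b ℕ.* suc m)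
      sq = begin-strict
        a ℕ.* suc n ℕ.* (a ℕ.* suc n)                      ≡⟨ square-* a (suc n) ⟩
        (a ℕ.* a) ℕ.* (suc n ℕ.* suc n)                    ≤⟨ ℕ.*-monoˡ-≤ (suc n ℕ.* suc n) a²≤ ⟩
        k ℕ.* (suc m ℕ.* suc m) ℕ.* (suc n ℕ.* suc n)      ≡⟨ ≡.trans (ℕ.*-assoc k _ _) (≡.trans (≡.cong (k ℕ.*_) (ℕ.*-comm (suc m ℕ.* suc m) (suc n ℕ.* suc n))) (≡.sym (ℕ.*-assoc k _ _))) ⟩
        k ℕ.* (suc n ℕ.* suc n) ℕ.* (suc m ℕ.* suc m)      <⟨ ℕ.*-monoˡ-< (suc m ℕ.* suc m) <[1+b]² ⟩
        suc b ℕ.* suc b ℕ.* (suc m ℕ.* suc m)              ≡⟨ square-* (suc b) (suc m) ⟨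
        suc b ℕ.* suc m ℕ.* (suc b ℕ.* suc m)              ∎
        where open ℕ.≤-Reasoning
      cross : a ℕ.* suc n ℕ.< suc b ℕ.* suc m
      cross = ℕ.≰⇒> λ ≥ → ℕ.<⇒≱ sq (ℕ.*-mono-≤ ≥ ≥)

    1/-small : ∀ ε → 0ℚ ℚ.< ε → ∀ n → ℚ.denominator-1 ε ℕ.≤ n → + 1 ℚ./ suc n ℚ.≤ ε
    1/-small ε@(mkℚ i d _) 0<ε n d≤n = ≡.subst (+ 1 ℚ./ suc n ℚ.≤_) (ℚ.↥p/↧p≡p ε)
      (/-mono-≤ (+ 1) n i d (help i (ℚ.positive 0<ε)))
      where
      help : ∀ i → ℤ.Positive i → + 1 ℤ.* + suc d ℤ.≤ i ℤ.* + suc n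
      help (+ suc i) _ = ≡.subst₂ ℤ._≤_ (ℤ.pos-* 1 (suc d)) (ℤ.pos-* (suc i) (suc n))
        (ℤ.+≤+ (ℕ.*-mono-≤ {1} {suc i} (ℕ.s≤s ℕ.z≤n) (ℕ.s≤s d≤n)))

    abstract
      √-cauchy : ∀ k → IsCauchy (√-seq k)
      √-cauchy k ε 0<ε = ℚ.denominator-1 ε , λ m n N≤m N≤n →
        [ (λ eq → ≡.subst (ℚ._< ε) (≡.sym eq) (ℚ.<-≤-trans (√-close k m n) (1/-small ε 0<ε n N≤n)))
        , (λ eq → ≡.subst (ℚ._< ε) (≡.trans (swap (√-seq k m) (√-seq k n)) (≡.sym eq)) (ℚ.<-≤-trans (√-close k n m) (1/-small ε 0<ε m N≤m)))
        ]′ (ℚ.∣p∣≡p∨∣p∣≡-p (√-seq k m ℚ.- √-seq k n))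
        where
        swap : ∀ p q → q ℚ.- p ≡ ℚ.- (p ℚ.- q)
        swap = solve 2 (λ p q → q :- p := :- (p :- q)) ≡.refl

  opaque
    √ : ℕ → ℝ
    √ k = real (√-seq k) (√-cauchy k)

open Reals public

module Reciprocals {c ℓ₁ ℓ₂} (K : HeytingField c ℓ₁ ℓ₂) where
  open HeytingField K
  open Algebra.Apartness.Properties.HeytingCommutativeRing heytingCommutativeRing using (x-0≈x; invertibleʳ⇒#)

  opaque
    recip : ∀ x → x # 0# → Carrier
    recip x x#0 = proj₁ (#⇒invertible x#0)

    recip-inverseʳ : ∀ x (x#0 : x # 0#) → x * recip x x#0 ≈ 1#
    recip-inverseʳ x x#0 = trans (*-congʳ (sym (x-0≈x x))) (proj₂ (proj₂ (#⇒invertible x#0)))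

    recip-inverseˡ : ∀ x (x#0 : x # 0#) → recip x x#0 * x ≈ 1#
    recip-inverseˡ x x#0 = trans (*-comm (recip x x#0) x) (recip-inverseʳ x x#0)

  x#y⇒x-y#0 : ∀ {x y} → x # y → x - y # 0#
  x#y⇒x-y#0 {x} {y} x#y = let (z , _ , eq) = #⇒invertible x#y in
    invertibleʳ⇒# (z , trans (*-congʳ (x-0≈x (x - y))) eq)

module Adjoin-i {c ℓ₁ ℓ₂} (F : HeytingField c ℓ₁ ℓ₂) where
  open HeytingField F
  private
    R : CommutativeRing c ℓ₁
    R = HeytingCommutativeRing.commutativeRing heytingCommutativeRing
  open Integers.Solver R

  infix 4 _≈ᶜ_ _#ᶜ_
  infixl 6 _+ᶜ_ _-ᶜ_
  infixl 7 _*ᶜ_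
  infix 8 -ᶜ_

  record F[i] : Set c where
    constructor _+i_
    field
      re im : Carrier
  open F[i] public

  record _≈ᶜ_ (z w : F[i]) : Set ℓ₁ where
    constructor mk≈ᶜ
    field
      re≈ : re z ≈ re w
      im≈ : im z ≈ im w

  _#ᶜ_ : F[i] → F[i] → Set ℓ₂
  z #ᶜ w = re z # re w ⊎ im z # im w

  _+ᶜ_ _*ᶜ_ : F[i] → F[i] → F[i]
  (a +i b) +ᶜ (c +i d) = (a + c) +i (b + d)
  (a +i b) *ᶜ (c +i d) = (a * c - b * d) +i (a * d + b * c)

  -ᶜ_ : F[i] → F[i]
  -ᶜ (a +i b) = (- a) +i (- b)

  _-ᶜ_ : F[i] → F[i] → F[i]
  z -ᶜ w = z +ᶜ (-ᶜ w)

  0ᶜ 1ᶜ : F[i]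
  0ᶜ = 0# +i 0#
  1ᶜ = 1# +i 0#

  abstract
    isCommutativeRingᶜ : IsCommutativeRing _≈ᶜ_ _+ᶜ_ _*ᶜ_ -ᶜ_ 0ᶜ 1ᶜ
    isCommutativeRingᶜ = record
      { isRing = record
        { +-isAbelianGroup = record
          { isGroup = record
            { isMonoid = record
              { isSemigroup = record
                { isMagma = record
                  { isEquivalence = record
                    { refl = mk≈ᶜ refl refl
                    ; sym = λ (mk≈ᶜ p q) → mk≈ᶜ (sym p) (sym q)
                    ; trans = λ (mk≈ᶜ p q) (mk≈ᶜ p′ q′) → mk≈ᶜ (trans p p′) (trans q q′)
                    }
                  ; ∙-cong = λ (mk≈ᶜ p q) (mk≈ᶜ p′ q′) → mk≈ᶜ (+-cong p p′) (+-cong q q′)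
                  }
                ; assoc = λ _ _ _ → mk≈ᶜ (+-assoc _ _ _) (+-assoc _ _ _)
                }
              ; identity = (λ _ → mk≈ᶜ (+-identityˡ _) (+-identityˡ _))
                         , (λ _ → mk≈ᶜ (+-identityʳ _) (+-identityʳ _))
              }
            ; inverse = (λ _ → mk≈ᶜ (-‿inverseˡ _) (-‿inverseˡ _))
                      , (λ _ → mk≈ᶜ (-‿inverseʳ _) (-‿inverseʳ _))
            ; ⁻¹-cong = λ (mk≈ᶜ p q) → mk≈ᶜ (-‿cong p) (-‿cong q)
            }
          ; comm = λ _ _ → mk≈ᶜ (+-comm _ _) (+-comm _ _)
          }
        ; *-cong = λ (mk≈ᶜ p q) (mk≈ᶜ p′ q′) → mk≈ᶜ
            (+-cong (*-cong p p′) (-‿cong (*-cong q q′)))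
            (+-cong (*-cong p q′) (*-cong q p′))
        ; *-assoc = λ (a +i b) (c +i d) (e +i f) → mk≈ᶜ
            (solve 6 (λ a b c d e f → (a :* c :- b :* d) :* e :- (a :* d :+ b :* c) :* f := a :* (c :* e :- d :* f) :- b :* (c :* f :+ d :* e)) refl a b c d e f)
            (solve 6 (λ a b c d e f → (a :* c :- b :* d) :* f :+ (a :* d :+ b :* c) :* e := a :* (c :* f :+ d :* e) :+ b :* (c :* e :- d :* f)) refl a b c d e f)
        ; *-identity =
            (λ (a +i b) → mk≈ᶜ
              (solve 2 (λ a b → con (+ 1) :* a :- con (+ 0) :* b := a) refl a b)
              (solve 2 (λ a b → con (+ 1) :* b :+ con (+ 0) :* a := b) refl a b))
          , (λ (a +i b) → mk≈ᶜ
              (solve 2 (λ a b → a :* con (+ 1) :- b :* con (+ 0) := a) refl a b)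
              (solve 2 (λ a b → a :* con (+ 0) :+ b :* con (+ 1) := b) refl a b))
        ; distrib =
            (λ (a +i b) (c +i d) (e +i f) → mk≈ᶜ
              (solve 6 (λ a b c d e f → a :* (c :+ e) :- b :* (d :+ f) := (a :* c :- b :* d) :+ (a :* e :- b :* f)) refl a b c d e f)
              (solve 6 (λ a b c d e f → a :* (d :+ f) :+ b :* (c :+ e) := (a :* d :+ b :* c) :+ (a :* f :+ b :* e)) refl a b c d e f))
          , (λ (a +i b) (c +i d) (e +i f) → mk≈ᶜ
              (solve 6 (λ a b c d e f → (c :+ e) :* a :- (d :+ f) :* b := (c :* a :- d :* b) :+ (e :* a :- f :* b)) refl a b c d e f)
              (solve 6 (λ a b c d e f → (c :+ e) :* b :+ (d :+ f) :* a := (c :* b :+ d :* a) :+ (e :* b :+ f :* a)) refl a b c d e f))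
        }
      ; *-comm = λ (a +i b) (c +i d) → mk≈ᶜ
          (solve 4 (λ a b c d → a :* c :- b :* d := c :* a :- d :* b) refl a b c d)
          (solve 4 (λ a b c d → a :* d :+ b :* c := c :* b :+ d :* a) refl a b c d)
      }

  commutativeRing : CommutativeRing c ℓ₁
  commutativeRing = record
    { Carrier = F[i]
    ; _≈_ = _≈ᶜ_
    ; _+_ = _+ᶜ_
    ; _*_ = _*ᶜ_
    ; -_ = -ᶜ_
    ; 0# = 0ᶜ
    ; 1# = 1ᶜ
    ; isCommutativeRing = isCommutativeRingᶜ
    }

  open Algebra.Apartness.Properties.HeytingCommutativeRing heytingCommutativeRing
    using (x-0≈x; invertibleʳ⇒#)
  open Algebra.Definitions _≈ᶜ_ using (Invertible)
  open CommutativeRing commutativeRing using () renaming (*-comm to *ᶜ-comm; trans to ≈ᶜ-trans)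
  open Reciprocals F using (x#y⇒x-y#0)

  product-#0⇒invertible : ∀ {x y} → x * y # 0# → ∃[ z ] x * z ≈ 1#
  product-#0⇒invertible {x} {y} xy#0 = let (z , _ , eq) = #⇒invertible xy#0 in
    y * z , trans (sym (*-assoc x y z)) (trans (*-congʳ (sym (x-0≈x (x * y)))) eq)

  module Field (sos-#0 : ∀ {x y} → x # 0# ⊎ y # 0# → x * x + y * y # 0#) where

    abstract
      #ᶜ⇒invertible : ∀ {z w} → z #ᶜ w → Invertible 1ᶜ _*ᶜ_ (z -ᶜ w)
      #ᶜ⇒invertible {z} {w} z#w = d⁻¹ , ≈ᶜ-trans (*ᶜ-comm d⁻¹ (z -ᶜ w)) dd⁻¹≈1 , dd⁻¹≈1
        where
        a b : Carrier
        a = re z - re w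
        b = im z - im w

        inverse : ∃[ n ] (a * a + b * b) * n ≈ 1#
        inverse = let (n , _ , eq) = #⇒invertible (sos-#0 (Sum.map x#y⇒x-y#0 x#y⇒x-y#0 z#w)) in
          n , trans (*-congʳ (sym (x-0≈x _))) eq

        n : Carrier
        n = proj₁ inverse

        d⁻¹ : F[i]
        d⁻¹ = (a * n) +i (- (b * n))

        dd⁻¹≈1 : (z -ᶜ w) *ᶜ d⁻¹ ≈ᶜ 1ᶜ
        dd⁻¹≈1 = mk≈ᶜ
          (trans (solve 3 (λ a b n → a :* (a :* n) :- b :* (:- (b :* n)) := (a :* a :+ b :* b) :* n) refl a b n) (proj₂ inverse))
          (solve 3 (λ a b n → a :* (:- (b :* n)) :+ b :* (a :* n) := con (+ 0)) refl a b n)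

      invertible⇒#ᶜ : ∀ {z w} → Invertible 1ᶜ _*ᶜ_ (z -ᶜ w) → z #ᶜ w
      invertible⇒#ᶜ {z} {w} (c +i d , _ , mk≈ᶜ eq _) =
        Sum.map (λ p → invertibleʳ⇒# (product-#0⇒invertible p))
                (λ p → invertibleʳ⇒# (product-#0⇒invertible (#-sym p)))
                (#-cotrans ac#bd 0#)
        where
        ac#bd : (re z - re w) * c # (im z - im w) * d
        ac#bd = invertibleʳ⇒# (1# , trans (*-identityʳ _) eq)

      isApartnessRelationᶜ : IsApartnessRelation _≈ᶜ_ _#ᶜ_
      isApartnessRelationᶜ = record
        { irrefl = λ (mk≈ᶜ p q) → [ #-irrefl p , #-irrefl q ]′
        ; sym = Sum.map #-sym #-sym
        ; cotrans = λ p z → [ (λ q → Sum.map inj₁ inj₁ (#-cotrans q (re z)))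
                            , (λ q → Sum.map inj₂ inj₂ (#-cotrans q (im z))) ]′ p
        }

      tightᶜ : Tight _≈ᶜ_ _#ᶜ_
      tightᶜ z w = (λ ¬z#w → mk≈ᶜ (proj₁ (tight (re z) (re w)) λ p → ¬z#w (inj₁ p))
                                  (proj₁ (tight (im z) (im w)) λ p → ¬z#w (inj₂ p)))
                 , (λ (mk≈ᶜ p q) → [ #-irrefl p , #-irrefl q ]′)

    heytingField : HeytingField c ℓ₁ ℓ₂
    heytingField = record
      { _#_ = _#ᶜ_
      ; isHeytingField = record
        { isHeytingCommutativeRing = record
          { isCommutativeRing = isCommutativeRingᶜ
          ; isApartnessRelation = isApartnessRelationᶜ
          ; #⇒invertible = #ᶜ⇒invertible
          ; invertible⇒# = invertible⇒#ᶜ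
          }
        ; tight = tightᶜ
        }
      }

open Adjoin-i ℝ-heytingField public
  using (_+i_; re; im; _≈ᶜ_; mk≈ᶜ; _#ᶜ_; _+ᶜ_; _-ᶜ_; _*ᶜ_; -ᶜ_; 0ᶜ; 1ᶜ)
  renaming (F[i] to ℂ; commutativeRing to ℂ-commutativeRing)

ℂ-heytingField : HeytingField 0ℓ 0ℓ 0ℓ
ℂ-heytingField = Adjoin-i.Field.heytingField ℝ-heytingField sum-of-squares-#0

-- The matrices Ψ(T), Ψ(S), Ψ(V), with w and w′ standing for ω^±1 and ω^∓1.
module Generators {c ℓ₁ ℓ₂} (K : HeytingField c ℓ₁ ℓ₂) where
  open HeytingField K
  private
    R : CommutativeRing c ℓ₁
    R = HeytingCommutativeRing.commutativeRing heytingCommutativeRing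
  open Reciprocals K
  open Projective R
  open Integers.Solver R
  open Relation.Binary.Reasoning.Setoid setoid

  module Matrices (w w′ : Carrier) (ww′≈1 : w * w′ ≈ 1#)
                  (r : Carrier) (r#0 : r # 0#) (r#w : r # w) (r#w′ : r # w′) where
    r⁻¹ [r-w]⁻¹ : Carrier
    r⁻¹ = recip r r#0
    [r-w]⁻¹ = recip (r - w) (x#y⇒x-y#0 r#w)

    matT matS matV : Mat₂
    matT = [ r  , 1#                      ∣ 0#      , 1#   ]
    matS = [ 1# , r⁻¹                     ∣ - r + w , - 1# ]
    matV = [ 1# , (1# + r⁻¹) * [r-w]⁻¹    ∣ 1# - r  , - 1# ]

    private
      [r-w′]⁻¹ : Carrier
      [r-w′]⁻¹ = recip (r - w′) (x#y⇒x-y#0 r#w′)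

    abstract
      unitT : Unit (det matT)
      unitT = unit r⁻¹ (trans
        (solve 2 (λ r u → (r :* con (+ 1) :- con (+ 1) :* con (+ 0)) :* u := r :* u) refl r r⁻¹)
        (recip-inverseʳ r r#0))

      unitS : Unit (det matS)
      unitS = unit (- (r * w′)) (begin
        (1# * - 1# - r⁻¹ * (- r + w)) * - (r * w′)
          ≈⟨ solve 4 (λ r u w v → (con (+ 1) :* (:- con (+ 1)) :- u :* (:- r :+ w)) :* (:- (r :* v))
                := (con (+ 1) :- r :* u) :* (r :* v) :+ (r :* u) :* (w :* v)) refl r r⁻¹ w w′ ⟩
        (1# - r * r⁻¹) * (r * w′) + (r * r⁻¹) * (w * w′)
          ≈⟨ +-cong (*-congʳ (+-congˡ (-‿cong rr⁻¹≈1))) (*-cong rr⁻¹≈1 ww′≈1) ⟩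
        (1# - 1#) * (r * w′) + 1# * 1#
          ≈⟨ solve 1 (λ x → (con (+ 1) :- con (+ 1)) :* x :+ con (+ 1) :* con (+ 1) := con (+ 1)) refl (r * w′) ⟩
        1# ∎)
        where
        rr⁻¹≈1 : r * r⁻¹ ≈ 1#
        rr⁻¹≈1 = recip-inverseʳ r r#0

      -- det matV = w (r - w′) / (r (r - w)): invertibility of V needs r ≠ w′ = w⁻¹
      -- in addition to the r ≠ w that makes its entries meaningful.
      unitV : Unit (det matV)
      unitV = unit (w′ * [r-w′]⁻¹ * (r * (r - w))) (begin
        (1# * - 1# - (1# + u) * s * (1# - r)) * (w′ * t * (r * (r - w)))
          ≈⟨ solve 6 (λ r u s w w′ t →
               (con (+ 1) :* (:- con (+ 1)) :- (con (+ 1) :+ u) :* s :* (con (+ 1) :- r)) :* (w′ :* t :* (r :* (r :- w)))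
               := w′ :* t :* ((:- (r :* (r :- w))) :- (r :+ r :* u) :* ((r :- w) :* s) :* (con (+ 1) :- r))) refl r u s w w′ t ⟩
        w′ * t * (- (r * (r - w)) - (r + r * u) * ((r - w) * s) * (1# - r))
          ≈⟨ *-congˡ (+-congˡ (-‿cong (*-congʳ (*-cong (+-congˡ (recip-inverseʳ r r#0)) (recip-inverseʳ (r - w) (x#y⇒x-y#0 r#w)))))) ⟩
        w′ * t * (- (r * (r - w)) - (r + 1#) * 1# * (1# - r))
          ≈⟨ solve 4 (λ r w w′ t →
               w′ :* t :* ((:- (r :* (r :- w))) :- (r :+ con (+ 1)) :* con (+ 1) :* (con (+ 1) :- r))
               := (w :* w′) :* (r :* t) :- w′ :* t) refl r w w′ t ⟩
        (w * w′) * (r * t) - w′ * t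
          ≈⟨ +-congʳ (*-congʳ ww′≈1) ⟩
        1# * (r * t) - w′ * t
          ≈⟨ solve 3 (λ r w′ t → con (+ 1) :* (r :* t) :- w′ :* t := (r :- w′) :* t) refl r w′ t ⟩
        (r - w′) * t
          ≈⟨ recip-inverseʳ (r - w′) (x#y⇒x-y#0 r#w′) ⟩
        1# ∎)
        where
        u s t : Carrier
        u = r⁻¹
        s = [r-w]⁻¹
        t = [r-w′]⁻¹

    glT glS glV : GL₂
    glT = gl matT unitT
    glS = gl matS unitS
    glV = gl matV unitV

module PGLℤ = Projective ℤ.+-*-commutativeRing
module PGLℂ = Projective ℂ-commutativeRing

PGL₂ℤ PGL₂ℂ : Group 0ℓ 0ℓ
PGL₂ℤ = PGLℤ.PGL₂
PGL₂ℂ = PGLℂ.PGL₂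

module _ where
  open PGLℤ

  -- The Möbius maps 1 + x, -1/x, 1/x, -x and 1 - x.
  T S U V K : GL₂
  T = gl [ 1ℤ  , 1ℤ  ∣ 0ℤ , 1ℤ ] (1ℤ , ≡.refl , ≡.refl)
  S = gl [ 0ℤ  , -1ℤ ∣ 1ℤ , 0ℤ ] (1ℤ , ≡.refl , ≡.refl)
  U = gl [ 0ℤ  , 1ℤ  ∣ 1ℤ , 0ℤ ] (-1ℤ , ≡.refl , ≡.refl)
  V = gl [ -1ℤ , 0ℤ  ∣ 0ℤ , 1ℤ ] (-1ℤ , ≡.refl , ≡.refl)
  K = gl [ -1ℤ , 1ℤ  ∣ 0ℤ , 1ℤ ] (-1ℤ , ≡.refl , ≡.refl)

module Embedding {c ℓ} (R : CommutativeRing c ℓ) where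
  open CommutativeRing R
  open Integers R using (fromℤ; fromℤ-+; fromℤ-*; fromℤ-neg)
  private
    module Z = Projective ℤ.+-*-commutativeRing
    module P = Projective R
    open module Reasoning = Relation.Binary.Reasoning.Setoid setoid

  matℤ : Z.Mat₂ → P.Mat₂
  matℤ Z.[ a , b ∣ c , d ] = P.[ fromℤ a , fromℤ b ∣ fromℤ c , fromℤ d ]

  abstract
    det-matℤ : ∀ A → fromℤ (Z.det A) ≈ P.det (matℤ A)
    det-matℤ Z.[ a , b ∣ c , d ] = begin
      fromℤ (a ℤ.* d ℤ.+ ℤ.- (b ℤ.* c))          ≈⟨ fromℤ-+ (a ℤ.* d) (ℤ.- (b ℤ.* c)) ⟩
      fromℤ (a ℤ.* d) + fromℤ (ℤ.- (b ℤ.* c))    ≈⟨ +-cong (fromℤ-* a d) (trans (fromℤ-neg (b ℤ.* c)) (-‿cong (fromℤ-* b c))) ⟩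
      fromℤ a * fromℤ d - fromℤ b * fromℤ c      ∎

    unit-matℤ : ∀ A → Z.Unit (Z.det A) → P.Unit (P.det (matℤ A))
    unit-matℤ A (y , _ , eq) = P.Unit-resp (det-matℤ A)
      (P.unit (fromℤ y) (trans (sym (fromℤ-* (Z.det A) y)) (reflexive (≡.cong fromℤ eq))))

  glℤ : Z.GL₂ → P.GL₂
  glℤ A = P.gl (matℤ (Z.matrix A)) (unit-matℤ (Z.matrix A) (Z.det-unit A))

ι : PGLℤ.GL₂ → PGLℂ.GL₂
ι = Embedding.glℤ ℂ-commutativeRing

open Reciprocals ℂ-heytingField using (recip; recip-inverseʳ; recip-inverseˡ)

-- e^{2πi/6} = cos (π/3) + i sin (π/3) = 1/2 + (√3/2) i
ω : ℂ
ω = fromℚ ½ +i (fromℚ ½ *ᴿ √ 3)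

ω#0 : ω #ᶜ 0ᶜ
ω#0 = inj₁ (mk# ½ (ℚ.positive⁻¹ ½) (0 , λ _ _ → ℚ.≤-refl))

-- ω^ + is ω¹ and ω^ - is ω⁻¹.
ω^ : Sign → ℂ
ω^ Sign.+ = ω
ω^ Sign.- = recip ω ω#0

ω^-inverse : ∀ s → ω^ s *ᶜ ω^ (Sign.opposite s) ≈ᶜ 1ᶜ
ω^-inverse Sign.+ = recip-inverseʳ ω ω#0
ω^-inverse Sign.- = recip-inverseˡ ω ω#0

φ φ̄ : ℂ
φ = (fromℚ ½ *ᴿ (1ᴿ +ᴿ √ 5)) +i 0ᴿ
φ̄ = (fromℚ ½ *ᴿ (1ᴿ -ᴿ √ 5)) +i 0ᴿ

record IsDyerAutomorphism (α : PGLℤ.GL₂ → PGLℤ.GL₂) : Set where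
  open PGLℤ using (_∼_; _∙_)
  field
    isAutomorphism : GroupMorphisms.IsGroupIsomorphism (Group.rawGroup PGL₂ℤ) (Group.rawGroup PGL₂ℤ) α
    involutive     : ∀ g → α (α g) ∼ g
    α-U            : α U ∼ U
    α-K            : α K ∼ K
    α-V            : α V ∼ U ∙ V

-- r#ω^ excludes both ω and ω⁻¹, whichever sign is chosen.
module Representation (± : Sign) (r : ℂ) (r#0 : r #ᶜ 0ᶜ) (r#ω^ : ∀ s → r #ᶜ ω^ s) where
  open Generators.Matrices ℂ-heytingField (ω^ ±) (ω^ (Sign.opposite ±)) (ω^-inverse ±) r r#0 (r#ω^ ±) (r#ω^ (Sign.opposite ±)) public

  record IsΨ (Ψ : PGLℤ.GL₂ → PGLℂ.GL₂) : Set where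
    open PGLℂ using (_∼_)
    field
      isHomomorphism : GroupMorphisms.IsGroupHomomorphism (Group.rawGroup PGL₂ℤ) (Group.rawGroup PGL₂ℂ) Ψ
      Ψ-T            : Ψ T ∼ glT
      Ψ-S            : Ψ S ∼ glS
      Ψ-V            : Ψ V ∼ glV

{-# OPTIONS --safe #-}

-- The quantity tr²/det is a conjugacy invariant of PGL₂(ℂ). At T it equals
-- (r + 1)²/r for Ψ and -1 for α, because α(T) = TU has trace 1 and determinant
-- -1; hence conjugacy forces r² + 3r + 1 = 0, whose roots are -φ² and -φ̄².
-- Conversely, for such r the matrix with rows (1 + r + rω^±1, ω^±1) and
-- (-1 + ω^±1 + rω^±1, 1), of determinant 2(1 + r), conjugates Ψ(T), Ψ(S), Ψ(V)
-- into α(T), α(S), α(V), and these determine the homomorphisms because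
-- the Euclidean algorithm shows that T, S, V generate PGL₂(ℤ).
module Submission where

open import Defs
open import Algebra.Apartness.Bundles using (HeytingCommutativeRing; HeytingField)
open import Algebra.Bundles using (CommutativeRing; Group)
open import Algebra.Morphism.Construct.Composition using (isGroupHomomorphism)
open import Algebra.Morphism.Structures using (module GroupMorphisms)
import Algebra.Properties.Group
open import Data.Integer.Base as ℤ using (ℤ; +_; -[1+_]; 0ℤ; 1ℤ; -1ℤ)
open import Data.Integer.DivMod using (_/_; _%_; a≡a%n+[a/n]*n; n%d<d)
import Data.Integer.Properties as ℤ
import Data.Integer.Solver as ℤ
open import Data.Nat.Base as ℕ using (zero; suc)
open import Data.Nat.Induction using (<-wellFounded)
import Data.Nat.Properties as ℕ
import Data.Nat.Solver as ℕ
open import Data.Product.Base using (∃-syntax; _×_; _,_)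
open import Data.Rational.Base as ℚ using (mkℚ; 0ℚ; ½; ∣_∣)
import Data.Rational.Properties as ℚ
import Data.Rational.Unnormalised.Base as ℚᵘ
import Data.Rational.Unnormalised.Properties as ℚᵘ
open import Data.Sign.Base as Sign using (Sign)
open import Data.Sum.Base using (_⊎_; inj₁; inj₂; [_,_]′)
open import Function.Base using (_∘_)
open import Function.Bundles using (_⇔_; mk⇔)
open import Induction.WellFounded using (Acc; acc)
open import Relation.Binary.PropositionalEquality as ≡ using (_≡_)
import Relation.Binary.Reasoning.Setoid

-- The square of the Cauchy real √k.

-- From km² < (a+1)² the gap is at most 2a, and a ≤ km because a² ≤ km² ≤ (km)². The bound is linear
-- in m, so it vanishes after division by m².
isqrt-error : ∀ k a m → a ℕ.* a ℕ.≤ k ℕ.* (m ℕ.* m) → k ℕ.* (m ℕ.* m) ℕ.< suc a ℕ.* suc a →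
              k ℕ.* (m ℕ.* m) ℕ.∸ a ℕ.* a ℕ.≤ 2 ℕ.* (k ℕ.* m)
isqrt-error k a m a²≤ <[1+a]² = begin
  k ℕ.* (m ℕ.* m) ℕ.∸ a ℕ.* a        ≤⟨ ℕ.∸-monoˡ-≤ (a ℕ.* a) (ℕ.≤-pred <[1+a]²) ⟩
  (a ℕ.+ a ℕ.* suc a) ℕ.∸ a ℕ.* a    ≡⟨ ≡.cong (ℕ._∸ a ℕ.* a) (solve 1 (λ a → a :+ a :* (con 1 :+ a) := con 2 :* a :+ a :* a) ≡.refl a) ⟩
  (2 ℕ.* a ℕ.+ a ℕ.* a) ℕ.∸ a ℕ.* a  ≡⟨ ℕ.m+n∸n≡m (2 ℕ.* a) (a ℕ.* a) ⟩
  2 ℕ.* a                            ≤⟨ ℕ.*-monoʳ-≤ 2 a≤km ⟩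
  2 ℕ.* (k ℕ.* m)                    ∎
  where
  open ℕ.≤-Reasoning
  open ℕ.+-*-Solver
  km²≤[km]² : ∀ k → k ℕ.* (m ℕ.* m) ℕ.≤ k ℕ.* m ℕ.* (k ℕ.* m)
  km²≤[km]² zero = ℕ.z≤n
  km²≤[km]² k@(suc j) = begin
    k ℕ.* (m ℕ.* m)            ≤⟨ ℕ.*-monoˡ-≤ (m ℕ.* m) (ℕ.m≤m*n k k) ⟩
    k ℕ.* k ℕ.* (m ℕ.* m)      ≡⟨ ℕ.[m*n]*[o*p]≡[m*o]*[n*p] k k m m ⟩
    k ℕ.* m ℕ.* (k ℕ.* m)      ∎
  a≤km : a ℕ.≤ k ℕ.* m
  a≤km = ℕ.≮⇒≥ λ km<a → ℕ.<⇒≱ (ℕ.*-mono-< km<a km<a) (ℕ.≤-trans a²≤ (km²≤[km]² k))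

-- With m = n + 1 and q the denominator of ε, `isqrt-error` bounds the error by 2km/m² = 2k/m. Since
-- 2kq ≤ n < m, this is below 1/q, and 1/q ≤ ε because the numerator of ε is at least 1.
√-seq-error : ∀ k n ε → 0ℚ ℚ.< ε → 2 ℕ.* (k ℕ.* ℚ.↧ₙ ε) ℕ.≤ n →
              ∣ √-seq k n ℚ.* √-seq k n ℚ.- + k ℚ./ 1 ∣ ℚ.< ε
√-seq-error k n ε 0<ε N≤n with isqrt (k ℕ.* (suc n ℕ.* suc n))
... | a , a²≤ , <[1+a]² = ℚ.toℚᵘ-cancel-< (ℚᵘ.<-respˡ-≃ (ℚᵘ.≃-sym unnormalised) (cross ε (ℚ.positive 0<ε) N≤n))
  where
  m = suc n
  s = + a ℚ./ m
  κ = + k ℚ./ 1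
  sᵘ = ℚᵘ.mkℚᵘ (+ a) n
  κᵘ = ℚᵘ.mkℚᵘ (+ k) 0

  -- Reduced fractions hide their numerators. Over unnormalised fractions the comparison with ε is a
  -- cross-multiplication of integers.
  unnormalised : ℚ.toℚᵘ ∣ s ℚ.* s ℚ.- κ ∣ ℚᵘ.≃ ℚᵘ.∣ sᵘ ℚᵘ.* sᵘ ℚᵘ.- κᵘ ∣
  unnormalised = begin
    ℚ.toℚᵘ ∣ s ℚ.* s ℚ.- κ ∣                          ≈⟨ ℚ.toℚᵘ-homo-∣-∣ (s ℚ.* s ℚ.- κ) ⟩
    ℚᵘ.∣ ℚ.toℚᵘ (s ℚ.* s ℚ.- κ) ∣                     ≈⟨ ℚᵘ.∣-∣-cong (ℚ.toℚᵘ-homo-+ (s ℚ.* s) (ℚ.- κ)) ⟩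
    ℚᵘ.∣ ℚ.toℚᵘ (s ℚ.* s) ℚᵘ.+ ℚ.toℚᵘ (ℚ.- κ) ∣       ≈⟨ ℚᵘ.∣-∣-cong (ℚᵘ.+-cong (ℚ.toℚᵘ-homo-* s s) (ℚ.toℚᵘ-homo‿- κ)) ⟩
    ℚᵘ.∣ ℚ.toℚᵘ s ℚᵘ.* ℚ.toℚᵘ s ℚᵘ.- ℚ.toℚᵘ κ ∣       ≈⟨ ℚᵘ.∣-∣-cong (ℚᵘ.+-cong (ℚᵘ.*-cong s≃ s≃) (ℚᵘ.-‿cong (ℚ.toℚᵘ-fromℚᵘ κᵘ))) ⟩
    ℚᵘ.∣ sᵘ ℚᵘ.* sᵘ ℚᵘ.- κᵘ ∣                         ∎
    where
    open Relation.Binary.Reasoning.Setoid ℚᵘ.≃-setoid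
    s≃ : ℚ.toℚᵘ s ℚᵘ.≃ sᵘ
    s≃ = ℚ.toℚᵘ-fromℚᵘ sᵘ

  -- The numerator of `sᵘ ℚᵘ.* sᵘ ℚᵘ.- κᵘ` exactly as unnormalised arithmetic leaves it, over the
  -- denominator m²·1.
  num : ℤ
  num = (+ a ℤ.* + a) ℤ.* + 1 ℤ.+ (ℤ.- (+ k)) ℤ.* + (m ℕ.* m)

  ∣num∣ : ℤ.∣ num ∣ ≡ k ℕ.* (m ℕ.* m) ℕ.∸ a ℕ.* a
  ∣num∣ = begin
    ℤ.∣ num ∣
      ≡⟨ ≡.cong₂ (λ x y → ℤ.∣ x ℤ.+ y ∣) (≡.trans (ℤ.*-identityʳ _) (≡.sym (ℤ.pos-* a a)))
           (≡.trans (≡.sym (ℤ.neg-distribˡ-* (+ k) (+ (m ℕ.* m)))) (≡.cong ℤ.-_ (≡.sym (ℤ.pos-* k (m ℕ.* m))))) ⟩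
    ℤ.∣ + (a ℕ.* a) ℤ.- + (k ℕ.* (m ℕ.* m)) ∣  ≡⟨ ≡.cong ℤ.∣_∣ (ℤ.m-n≡m⊖n (a ℕ.* a) (k ℕ.* (m ℕ.* m))) ⟩
    ℤ.∣ a ℕ.* a ℤ.⊖ k ℕ.* (m ℕ.* m) ∣          ≡⟨ ℤ.∣⊖∣-≤ a²≤ ⟩
    k ℕ.* (m ℕ.* m) ℕ.∸ a ℕ.* a                ∎
    where open ≡.≡-Reasoning

  cross : ∀ ε → ℚ.Positive ε → 2 ℕ.* (k ℕ.* ℚ.↧ₙ ε) ℕ.≤ n → ℚᵘ.∣ sᵘ ℚᵘ.* sᵘ ℚᵘ.- κᵘ ∣ ℚᵘ.< ℚ.toℚᵘ ε
  cross (mkℚ (+ suc p) d _) _ N≤n = ℚᵘ.*<* (≡.subst₂ ℤ._<_ (ℤ.pos-* ℤ.∣ num ∣ (suc d)) (ℤ.pos-* (suc p) (m ℕ.* m ℕ.* 1)) (ℤ.+<+ (begin-strict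
    ℤ.∣ num ∣ ℕ.* suc d                       ≡⟨ ≡.cong (ℕ._* suc d) ∣num∣ ⟩
    (k ℕ.* (m ℕ.* m) ℕ.∸ a ℕ.* a) ℕ.* suc d   ≤⟨ ℕ.*-monoˡ-≤ (suc d) (isqrt-error k a m a²≤ <[1+a]²) ⟩
    2 ℕ.* (k ℕ.* m) ℕ.* suc d                 ≡⟨ solve 3 (λ k m d → con 2 :* (k :* m) :* d := con 2 :* (k :* d) :* m) ≡.refl k m (suc d) ⟩
    2 ℕ.* (k ℕ.* suc d) ℕ.* m                 <⟨ ℕ.*-monoˡ-< m (ℕ.s≤s N≤n) ⟩
    m ℕ.* m                                   ≡⟨ ℕ.*-identityʳ (m ℕ.* m) ⟨
    m ℕ.* m ℕ.* 1                             ≤⟨ ℕ.m≤n*m (m ℕ.* m ℕ.* 1) (suc p) ⟩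
    suc p ℕ.* (m ℕ.* m ℕ.* 1)                 ∎)))
    where
    open ℕ.≤-Reasoning
    open ℕ.+-*-Solver

opaque
  unfolding _+ᴿ_ _*ᴿ_ √

  √-square : ∀ k → √ k *ᴿ √ k ≈ᴿ fromℚ (+ k ℚ./ 1)
  √-square k = mk≈ λ ε 0<ε → 2 ℕ.* (k ℕ.* ℚ.↧ₙ ε) , λ n → √-seq-error k n ε 0<ε

  fromℚ-+ : ∀ p q → fromℚ (p ℚ.+ q) ≈ᴿ fromℚ p +ᴿ fromℚ q
  fromℚ-+ p q = pointwise λ _ → ≡.refl

-- Generation of PGL₂(ℤ) by T, S and V.

module Generation where
  open PGLℤ

  translation : ℤ → GL₂
  translation n = gl [ 1ℤ , n ∣ 0ℤ , 1ℤ ]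
    (Unit-resp (≡.cong (λ t → 1ℤ ℤ.+ ℤ.- t) (≡.sym (ℤ.*-zeroʳ n))) Unit-1)

  unit⇒±1 : ∀ i j → i ℤ.* j ≡ 1ℤ → i ≡ 1ℤ ⊎ i ≡ -1ℤ
  unit⇒±1 i j ij≡1 = sign i (ℕ.m*n≡1⇒m≡1 ℤ.∣ i ∣ ℤ.∣ j ∣ (≡.trans (≡.sym (ℤ.abs-* i j)) (≡.cong ℤ.∣_∣ ij≡1)))
    where
    sign : ∀ i → ℤ.∣ i ∣ ≡ 1 → i ≡ 1ℤ ⊎ i ≡ -1ℤ
    sign (+ 1)    _ = inj₁ ≡.refl
    sign -[1+ 0 ] _ = inj₂ ≡.refl

  module _ {p} (P : GL₂ → Set p) (resp : ∀ {A B} → A ∼ B → P A → P B)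
           (∙-closed : ∀ {A B} → P A → P B → P (A ∙ B)) (⁻¹-closed : ∀ {A} → P A → P (A ⁻¹))
           (P-T : P T) (P-S : P S) (P-V : P V) where

    private
      open ℤ.+-*-Solver

      P-ε : P ε
      P-ε = resp (≋⇒∼ {S ∙ S ⁻¹} (mk≋ ≡.refl ≡.refl ≡.refl ≡.refl)) (∙-closed P-S (⁻¹-closed P-S))

      P-translation⁺ : ∀ n → P (translation (+ n))
      P-translation⁺ zero = resp (≋⇒∼ (mk≋ ≡.refl ≡.refl ≡.refl ≡.refl)) P-ε
      P-translation⁺ (suc n) = resp
        (≋⇒∼ {T ∙ translation (+ n)} (mk≋ ≡.refl
          (solve 1 (λ n → con 1ℤ :* n :+ con 1ℤ :* con 1ℤ := con 1ℤ :+ n) ≡.refl (+ n)) ≡.refl ≡.refl))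
        (∙-closed P-T (P-translation⁺ n))

      P-translation : ∀ n → P (translation n)
      P-translation (+ n)    = P-translation⁺ n
      P-translation -[1+ n ] = resp (≋⇒∼ (mk≋ ≡.refl ≡.refl ≡.refl ≡.refl)) (⁻¹-closed (P-translation⁺ (suc n)))

      -- The determinant ad is a unit, so a and d are ±1. Up to the scalar -1 the matrix is then
      -- T^(±b) when a = d, and T^(±b) V otherwise.
      P-triangular : ∀ a b d (u : Unit (PGLℤ.det [ a , b ∣ 0ℤ , d ])) → P (gl [ a , b ∣ 0ℤ , d ] u)
      P-triangular a b d u@(y , _ , eq) = cases (unit⇒±1 a (d ℤ.* y) (≡.trans
          (solve 4 (λ a b d y → a :* (d :* y) := (a :* d :- b :* con 0ℤ) :* y) ≡.refl a b d y) eq))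
        (unit⇒±1 d (a ℤ.* y) (≡.trans
          (solve 4 (λ a b d y → d :* (a :* y) := (a :* d :- b :* con 0ℤ) :* y) ≡.refl a b d y) eq))
        where
        -1-unit : Unit -1ℤ
        -1-unit = -1ℤ , ≡.refl , ≡.refl

        -n≡-1*n : ∀ n → ℤ.- n ≡ -1ℤ ℤ.* n
        -n≡-1*n = solve 1 (λ n → :- n := con -1ℤ :* n) ≡.refl

        [TⁿV]₁₁ : ∀ n → 1ℤ ℤ.* -1ℤ ℤ.+ n ℤ.* 0ℤ ≡ -1ℤ
        [TⁿV]₁₁ = solve 1 (λ n → con 1ℤ :* con -1ℤ :+ n :* con 0ℤ := con -1ℤ) ≡.refl

        [TⁿV]₁₂ : ∀ n → 1ℤ ℤ.* 0ℤ ℤ.+ n ℤ.* 1ℤ ≡ n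
        [TⁿV]₁₂ = solve 1 (λ n → con 1ℤ :* con 0ℤ :+ n :* con 1ℤ := n) ≡.refl

        cases : a ≡ 1ℤ ⊎ a ≡ -1ℤ → d ≡ 1ℤ ⊎ d ≡ -1ℤ → P (gl [ a , b ∣ 0ℤ , d ] u)
        cases (inj₁ ≡.refl) (inj₁ ≡.refl) = resp
          (≋⇒∼ (mk≋ ≡.refl ≡.refl ≡.refl ≡.refl))
          (P-translation b)
        cases (inj₂ ≡.refl) (inj₂ ≡.refl) = resp
          (scaled -1ℤ -1-unit (mk≋ ≡.refl (-n≡-1*n b) ≡.refl ≡.refl))
          (P-translation (ℤ.- b))
        cases (inj₂ ≡.refl) (inj₁ ≡.refl) = resp
          (≋⇒∼ {translation b ∙ V} (mk≋ ([TⁿV]₁₁ b) ([TⁿV]₁₂ b) ≡.refl ≡.refl))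
          (∙-closed (P-translation b) P-V)
        cases (inj₁ ≡.refl) (inj₂ ≡.refl) = resp
          (scaled {A = translation (ℤ.- b) ∙ V} -1ℤ -1-unit
            (mk≋ ([TⁿV]₁₁ (ℤ.- b)) (≡.trans ([TⁿV]₁₂ (ℤ.- b)) (-n≡-1*n b)) ≡.refl ≡.refl))
          (∙-closed (P-translation (ℤ.- b)) P-V)

      -- With q the quotient of a by c, [ a , b ∣ c , d ] is T^q S times the matrix recursed on.
      euclid : ∀ a b c d u → Acc ℕ._<_ ℤ.∣ c ∣ → P (gl [ a , b ∣ c , d ] u)
      step : ∀ a b c d u → Acc ℕ._<_ ℤ.∣ c ∣ → .{{_ : ℤ.NonZero c}} → P (gl [ a , b ∣ c , d ] u)

      euclid a b (+ 0)      d u _  = P-triangular a b d u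
      euclid a b c@(+ suc _)  d u wf = step a b c d u wf
      euclid a b c@(-[1+ _ ]) d u wf = step a b c d u wf

      step a b c d u (acc rec) = resp
        (≋⇒∼ {translation q ∙ (S ∙ gl [ c , d ∣ ℤ.- ρ , q ℤ.* d ℤ.- b ] u′)} {gl [ a , b ∣ c , d ] u} (mk≋
          (≡.trans (solve 3 (λ c q ρ → con 1ℤ :* (con 0ℤ :* c :+ con -1ℤ :* (:- ρ)) :+ q :* (con 1ℤ :* c :+ con 0ℤ :* (:- ρ)) := ρ :+ q :* c) ≡.refl c q ρ) (≡.sym a≡))
          (solve 3 (λ b d q → con 1ℤ :* (con 0ℤ :* d :+ con -1ℤ :* (q :* d :- b)) :+ q :* (con 1ℤ :* d :+ con 0ℤ :* (q :* d :- b)) := b) ≡.refl b d q)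
          (lower-row c (ℤ.- ρ))
          (lower-row d (q ℤ.* d ℤ.- b))))
        (∙-closed (P-translation q) (∙-closed P-S (euclid c d (ℤ.- ρ) (q ℤ.* d ℤ.- b) u′ (rec ∣-ρ∣<∣c∣))))
        where
        q ρ : ℤ
        q = a / c
        ρ = + (a % c)

        a≡ : a ≡ ρ ℤ.+ q ℤ.* c
        a≡ = a≡a%n+[a/n]*n a c

        ∣-ρ∣<∣c∣ : ℤ.∣ ℤ.- ρ ∣ ℕ.< ℤ.∣ c ∣
        ∣-ρ∣<∣c∣ = ≡.subst (ℕ._< ℤ.∣ c ∣) (≡.sym (ℤ.∣-i∣≡∣i∣ ρ)) (n%d<d a c)

        lower-row : ∀ x y → 0ℤ ℤ.* (0ℤ ℤ.* x ℤ.+ -1ℤ ℤ.* y) ℤ.+ 1ℤ ℤ.* (1ℤ ℤ.* x ℤ.+ 0ℤ ℤ.* y) ≡ x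
        lower-row = solve 2 (λ x y → con 0ℤ :* (con 0ℤ :* x :+ con -1ℤ :* y) :+ con 1ℤ :* (con 1ℤ :* x :+ con 0ℤ :* y) := x) ≡.refl

        -- T^q S has determinant 1, so the determinant is unchanged.
        u′ : Unit (PGLℤ.det [ c , d ∣ ℤ.- ρ , q ℤ.* d ℤ.- b ])
        u′ = Unit-resp (≡.trans (≡.cong (λ t → t ℤ.* d ℤ.- b ℤ.* c) a≡)
          (solve 5 (λ b c d q ρ → (ρ :+ q :* c) :* d :- b :* c := c :* (q :* d :- b) :- d :* (:- ρ)) ≡.refl b c d q ρ)) u

    -- Generation phrased as an induction principle, so that no word in the generators has to be
    -- formed. The Euclidean algorithm on the first column shrinks the lower left entry until the
    -- matrix is triangular.
    generated : ∀ A → P A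
    generated (gl [ a , b ∣ c , d ] u) = euclid a b c d u (<-wellFounded _)

  -- The elements where two homomorphisms agree are closed under products, inverses and change of
  -- representative, so `generated` applies to them.
  homomorphisms-agree : ∀ {c ℓ} (G : Group c ℓ) {f h : GL₂ → Group.Carrier G} →
    let open Group G using (_≈_)
        open GroupMorphisms (Group.rawGroup PGL₂ℤ) (Group.rawGroup G)
    in IsGroupHomomorphism f → IsGroupHomomorphism h → f T ≈ h T → f S ≈ h S → f V ≈ h V → ∀ A → f A ≈ h A
  homomorphisms-agree G {f} {h} f-hom h-hom = generated (λ A → f A ≈ h A)
    (λ A∼B fA≈hA → trans (F.⟦⟧-cong (∼-sym A∼B)) (trans fA≈hA (H.⟦⟧-cong A∼B)))
    (λ {A} {B} fA≈hA fB≈hB → trans (F.homo A B) (trans (∙-cong′ fA≈hA fB≈hB) (sym (H.homo A B))))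
    (λ {A} fA≈hA → trans (F.⁻¹-homo A) (trans (⁻¹-cong′ fA≈hA) (sym (H.⁻¹-homo A))))
    where
    open Group G using (_≈_; sym; trans) renaming (∙-cong to ∙-cong′; ⁻¹-cong to ⁻¹-cong′)
    module F = GroupMorphisms.IsGroupHomomorphism f-hom
    module H = GroupMorphisms.IsGroupHomomorphism h-hom

  -- This and `S∼U∙V` express T and S through U, K and V, the elements at which α is prescribed.
  T∼K∙V : T ∼ K ∙ V
  T∼K∙V = ≋⇒∼ (mk≋ ≡.refl ≡.refl ≡.refl ≡.refl)

  S∼U∙V : S ∼ U ∙ V
  S∼U∙V = scaled -1ℤ (-1ℤ , ≡.refl , ≡.refl) (mk≋ ≡.refl ≡.refl ≡.refl ≡.refl)

-- Conjugation in a group.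

module Conjugation {c ℓ} (G : Group c ℓ) where
  open Group G
  open Algebra.Properties.Group G
  open Relation.Binary.Reasoning.Setoid setoid
  open GroupMorphisms rawGroup rawGroup

  conjugation-isGroupHomomorphism : ∀ x → IsGroupHomomorphism (λ y → x ∙ y ∙ x ⁻¹)
  conjugation-isGroupHomomorphism x = record
    { isMonoidHomomorphism = record
      { isMagmaHomomorphism = record
        { isRelHomomorphism = record { cong = λ y≈z → ∙-congʳ (∙-congˡ y≈z) }
        ; homo = homo
        }
      ; ε-homo = trans (∙-congʳ (identityʳ x)) (inverseʳ x)
      }
    ; ⁻¹-homo = λ y → inverseˡ-unique _ _ (begin
        (x ∙ y ⁻¹ ∙ x ⁻¹) ∙ (x ∙ y ∙ x ⁻¹)  ≈⟨ homo (y ⁻¹) y ⟨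
        x ∙ (y ⁻¹ ∙ y) ∙ x ⁻¹              ≈⟨ ∙-congʳ (trans (∙-congˡ (inverseˡ y)) (identityʳ x)) ⟩
        x ∙ x ⁻¹                           ≈⟨ inverseʳ x ⟩
        ε                                  ∎)
    }
    where
    homo : ∀ y z → x ∙ (y ∙ z) ∙ x ⁻¹ ≈ (x ∙ y ∙ x ⁻¹) ∙ (x ∙ z ∙ x ⁻¹)
    homo y z = begin
      x ∙ (y ∙ z) ∙ x ⁻¹                   ≈⟨ ∙-congʳ (assoc x y z) ⟨
      x ∙ y ∙ z ∙ x ⁻¹                     ≈⟨ ∙-congʳ (∙-congˡ (\\-leftDividesʳ x z)) ⟨
      x ∙ y ∙ (x ⁻¹ ∙ (x ∙ z)) ∙ x ⁻¹      ≈⟨ ∙-congʳ (assoc _ _ _) ⟨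
      x ∙ y ∙ x ⁻¹ ∙ (x ∙ z) ∙ x ⁻¹        ≈⟨ assoc _ _ _ ⟩
      (x ∙ y ∙ x ⁻¹) ∙ (x ∙ z ∙ x ⁻¹)      ∎

  -- Reduces conjugacy to an intertwining relation, which keeps the inverse of the conjugating
  -- matrix out of the entry computations.
  xy≈zx⇒xyx⁻¹≈z : ∀ {x y z} → x ∙ y ≈ z ∙ x → x ∙ y ∙ x ⁻¹ ≈ z
  xy≈zx⇒xyx⁻¹≈z {x} {z = z} xy≈zx = trans (∙-congʳ xy≈zx) (//-rightDividesʳ x z)

-- The conjugacy invariant tr²/det.

module Trace {c ℓ} (R : CommutativeRing c ℓ) where
  open CommutativeRing R
  open Integers R using (fromℤ)
  open Integers.Solver R
  open Projective R
  open Relation.Binary.Reasoning.Setoid setoid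

  tr : Mat₂ → Carrier
  tr [ a , b ∣ c , d ] = a + d

  -- `adj M` is `det M` times the inverse of M, so the invariant trace acquires one factor `det M`;
  -- the determinant below acquires two.
  tr-conjugate : ∀ M A → tr (M · A · adj M) ≈ det M * tr A
  tr-conjugate [ m , n ∣ p , q ] [ a , b ∣ c , d ] =
    solve 8 (λ m n p q a b c d →
      ((m :* a :+ n :* c) :* q :+ (m :* b :+ n :* d) :* (:- p)) :+ ((p :* a :+ q :* c) :* (:- n) :+ (p :* b :+ q :* d) :* m)
        := (m :* q :- n :* p) :* (a :+ d))
      refl m n p q a b c d

  det-conjugate : ∀ M A → det (M · A · adj M) ≈ det M * det M * det A
  det-conjugate M A = begin
    det (M · A · adj M)            ≈⟨ trans (det-· (M · A) (adj M)) (*-cong (det-· M A) (det-adj M)) ⟩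
    det M * det A * det M          ≈⟨ solve 2 (λ m a → m :* a :* m := m :* m :* a) refl (det M) (det A) ⟩
    det M * det M * det A          ∎

  tr-≋⊙ : ∀ {A k B} → A ≋ k ⊙ B → tr A ≈ k * tr B
  tr-≋⊙ (mk≋ p _ _ s) = trans (+-cong p s) (sym (distribˡ _ _ _))

  det-≋⊙ : ∀ {A k B} → A ≋ k ⊙ B → det A ≈ k * k * det B
  det-≋⊙ {k = k} {[ a , b ∣ c , d ]} (mk≋ p q r s) = trans (+-cong (*-cong p s) (-‿cong (*-cong q r)))
    (solve 5 (λ k a b c d → k :* a :* (k :* d) :- k :* b :* (k :* c) := k :* k :* (a :* d :- b :* c)) refl k a b c d)

  *-cancelˡ-unit : ∀ {x y z} → Unit x → x * y ≈ x * z → y ≈ z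
  *-cancelˡ-unit {x} {y} {z} (x⁻¹ , x⁻¹x≈1 , _) xy≈xz = begin
    y              ≈⟨ cancel y ⟨
    x⁻¹ * (x * y)  ≈⟨ *-congˡ xy≈xz ⟩
    x⁻¹ * (x * z)  ≈⟨ cancel z ⟩
    z              ∎
    where
    cancel : ∀ t → x⁻¹ * (x * t) ≈ t
    cancel t = trans (sym (*-assoc _ _ _)) (trans (*-congʳ x⁻¹x≈1) (*-identityˡ t))

  -- Equality of tr²/det, cross-multiplied. Trace squared and determinant are both homogeneous of
  -- degree 2, so k² merely moves from the trace of B to its determinant, and only the unit δ² is
  -- cancelled.
  conjugate⇒tr²/det : ∀ {M A B} → M ∙ A ∙ M ⁻¹ ∼ B →
    tr (matrix A) * tr (matrix A) * det (matrix B) ≈ tr (matrix B) * tr (matrix B) * det (matrix A)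
  conjugate⇒tr²/det {gl M u} {gl A _} {gl B _} (scaled k _ MAM⁻¹≋kB) =
    *-cancelˡ-unit (Unit-* u u) (begin
      δ * δ * (tr A * tr A * det B)      ≈⟨ solve 3 (λ δ a b → δ :* δ :* (a :* a :* b) := (δ :* a) :* (δ :* a) :* b) refl δ (tr A) (det B) ⟩
      (δ * tr A) * (δ * tr A) * det B    ≈⟨ *-congʳ (*-cong tr-eq tr-eq) ⟩
      (k * tr B) * (k * tr B) * det B    ≈⟨ solve 3 (λ k t b → (k :* t) :* (k :* t) :* b := t :* t :* (k :* k :* b)) refl k (tr B) (det B) ⟩
      tr B * tr B * (k * k * det B)      ≈⟨ *-congˡ det-eq ⟨
      tr B * tr B * (δ * δ * det A)      ≈⟨ solve 3 (λ t δ a → t :* t :* (δ :* δ :* a) := δ :* δ :* (t :* t :* a)) refl (tr B) δ (det A) ⟩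
      δ * δ * (tr B * tr B * det A)      ∎)
    where
    δ : Carrier
    δ = det M
    tr-eq : δ * tr A ≈ k * tr B
    tr-eq = trans (sym (tr-conjugate M A)) (tr-≋⊙ MAM⁻¹≋kB)
    det-eq : δ * δ * det A ≈ k * k * det B
    det-eq = trans (sym (det-conjugate M A)) (det-≋⊙ MAM⁻¹≋kB)

  -- B is the matrix product K(UV), that is -TU, representing α(T). Its trace and determinant are
  -- both -1, so the hypothesis reads -(r + 1)² = r.
  tr²/det-T⇒root : ∀ {r} → let A = [ r , 1# ∣ 0# , 1# ]; B = [ - 1# , - 1# ∣ - 1# , 0# ] in
    tr A * tr A * det B ≈ tr B * tr B * det A → r * r + fromℤ (+ 3) * r + 1# ≈ 0#
  tr²/det-T⇒root {r} eq = begin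
    r * r + fromℤ (+ 3) * r + 1#
      ≈⟨ solve 1 (λ r → r :* r :+ con (+ 3) :* r :+ con (+ 1)
           := (con -1ℤ :+ con (+ 0)) :* (con -1ℤ :+ con (+ 0)) :* (r :* con (+ 1) :- con (+ 1) :* con (+ 0))
              :- (r :+ con (+ 1)) :* (r :+ con (+ 1)) :* (con -1ℤ :* con (+ 0) :- con -1ℤ :* con -1ℤ)) refl r ⟩
    tr B * tr B * det A - tr A * tr A * det B  ≈⟨ +-congˡ (-‿cong eq) ⟩
    tr B * tr B * det A - tr B * tr B * det A  ≈⟨ -‿inverseʳ _ ⟩
    0#                                         ∎
    where
    A B : Mat₂
    A = [ r , 1# ∣ 0# , 1# ]
    B = [ - 1# , - 1# ∣ - 1# , 0# ]

-- The map PGL₂(ℤ) → PGL₂(R) is a homomorphism.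

module EmbeddingProperties {c ℓ} (R : CommutativeRing c ℓ) where
  open CommutativeRing R
  open Integers R using (fromℤ; fromℤ-+; fromℤ-*; fromℤ-neg)
  open Embedding R using (glℤ)
  private
    module Z = Projective ℤ.+-*-commutativeRing
    module P = Projective R

  fromℤ-unit : ∀ {i} → Z.Unit i → P.Unit (fromℤ i)
  fromℤ-unit {i} (j , _ , ij≡1) = P.unit (fromℤ j) (trans (sym (fromℤ-* i j)) (reflexive (≡.cong fromℤ ij≡1)))

  glℤ-cong : ∀ {A B} → A Z.∼ B → glℤ A P.∼ glℤ B
  glℤ-cong (Z.scaled k u (Z.mk≋ p q r s)) = P.scaled (fromℤ k) (fromℤ-unit u) (P.mk≋ (f p) (f q) (f r) (f s))
    where
    f : ∀ {i j} → i ≡ k ℤ.* j → fromℤ i ≈ fromℤ k * fromℤ j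
    f {j = j} ≡.refl = fromℤ-* k j

  glℤ-∙ : ∀ A B → glℤ (A Z.∙ B) P.∼ glℤ A P.∙ glℤ B
  glℤ-∙ (Z.gl Z.[ a , b ∣ c , d ] _) (Z.gl Z.[ a′ , b′ ∣ c′ , d′ ] _) = P.≋⇒∼ (P.mk≋ (f a a′ b c′) (f a b′ b d′) (f c a′ d c′) (f c b′ d d′))
    where
    f : ∀ i j k l → fromℤ (i ℤ.* j ℤ.+ k ℤ.* l) ≈ fromℤ i * fromℤ j + fromℤ k * fromℤ l
    f i j k l = trans (fromℤ-+ (i ℤ.* j) (k ℤ.* l)) (+-cong (fromℤ-* i j) (fromℤ-* k l))

  glℤ-⁻¹ : ∀ A → glℤ (A Z.⁻¹) P.∼ glℤ A P.⁻¹
  glℤ-⁻¹ (Z.gl Z.[ _ , b ∣ c , _ ] _) = P.≋⇒∼ (P.mk≋ refl (fromℤ-neg b) (fromℤ-neg c) refl)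

  glℤ-isGroupHomomorphism : GroupMorphisms.IsGroupHomomorphism (Group.rawGroup Z.PGL₂) (Group.rawGroup P.PGL₂) glℤ
  glℤ-isGroupHomomorphism = record
    { isMonoidHomomorphism = record
      { isMagmaHomomorphism = record
        { isRelHomomorphism = record { cong = glℤ-cong }
        ; homo = glℤ-∙
        }
      ; ε-homo = P.≋⇒∼ (P.mk≋ refl refl refl refl)
      }
    ; ⁻¹-homo = glℤ-⁻¹
    }

-- The explicit conjugating matrix.

module Conjugator {c ℓ} (R : CommutativeRing c ℓ) where
  open CommutativeRing R
  open Integers R using (fromℤ)
  open Projective R
  open Integers.Solver R
  open Relation.Binary.Reasoning.Setoid setoid

  module Relations {r r⁻¹ w [r-w]⁻¹ ½ : Carrier}
    (r²+3r+1≈0 : r * r + fromℤ (+ 3) * r + 1# ≈ 0#) (w²-w+1≈0 : w * w - w + 1# ≈ 0#)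
    (rr⁻¹≈1 : r * r⁻¹ ≈ 1#) ([r-w][r-w]⁻¹≈1 : (r - w) * [r-w]⁻¹ ≈ 1#) (½+½≈1 : ½ + ½ ≈ 1#) where

    private
      u s h : Carrier
      u = r⁻¹
      s = [r-w]⁻¹
      h = ½

      :0 :1 :2 :3 : ∀ {n} → Polynomial n
      :0 = con (+ 0)
      :1 = con (+ 1)
      :2 = con (+ 2)
      :3 = con (+ 3)

      -- Solver syntax for the first column of `matM` and, with `κᵥ`, for the scalars `kₜ`, `kₛ`,
      -- `kᵥ` below.
      m₁₁ m₂₁ κₜ κₛ : ∀ {n} (r w : Polynomial n) → Polynomial n
      m₁₁ r w = :1 :+ r :+ r :* w
      m₂₁ r w = :- :1 :+ w :+ r :* w
      κₜ r w = :- (:1 :+ r)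
      κₛ r w = (:2 :+ r) :* (:1 :- w)

      κᵥ : ∀ {n} (w s : Polynomial n) → Polynomial n
      κᵥ w s = :2 :* (w :- :1) :* s

      -- The ideal of relations among r, w, u = r⁻¹ and s = (r - w)⁻¹; each matrix
      -- entry below is verified by exhibiting its cofactors c₁, …, c₄.
      combination : ∀ {n} (r w u s c₁ c₂ c₃ c₄ : Polynomial n) → Polynomial n
      combination r w u s c₁ c₂ c₃ c₄ =
        c₁ :* (r :* r :+ :3 :* r :+ :1) :+ c₂ :* (w :* w :- w :+ :1)
          :+ c₃ :* (r :* u :- :1) :+ c₄ :* ((r :- w) :* s :- :1)

      modulo : ∀ {c₁ c₂ c₃ c₄ x y} →
        x ≈ y + (c₁ * (r * r + fromℤ (+ 3) * r + 1#) + c₂ * (w * w - w + 1#)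
                  + c₃ * (r * u - 1#) + c₄ * ((r - w) * s - 1#)) → x ≈ y
      modulo {c₁} {c₂} {c₃} {c₄} {x} {y} eq = begin
        x   ≈⟨ eq ⟩
        _   ≈⟨ +-congˡ (+-cong (+-cong (+-cong (*-congˡ r²+3r+1≈0) (*-congˡ w²-w+1≈0))
                 (*-congˡ (≈1⇒-1≈0 rr⁻¹≈1))) (*-congˡ (≈1⇒-1≈0 [r-w][r-w]⁻¹≈1))) ⟩
        y + (c₁ * 0# + c₂ * 0# + c₃ * 0# + c₄ * 0#)
            ≈⟨ solve 5 (λ y a b c d → y :+ (a :* :0 :+ b :* :0 :+ c :* :0 :+ d :* :0) := y)
                 refl y c₁ c₂ c₃ c₄ ⟩
        y   ∎
        where
        ≈1⇒-1≈0 : ∀ {t} → t ≈ 1# → t - 1# ≈ 0#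
        ≈1⇒-1≈0 t≈1 = trans (+-congʳ t≈1) (-‿inverseʳ 1#)

    -- The solution, unique up to scalars, of the linear system M-T, M-S, M-V.
    matM : Mat₂
    matM = [ 1# + r + r * w , w ∣ - 1# + w + r * w , 1# ]

    kₜ kₛ kᵥ : Carrier
    kₜ = - (1# + r)
    kₛ = (fromℤ (+ 2) + r) * (1# - w)
    kᵥ = fromℤ (+ 2) * (w - 1#) * s

    abstract
      -- Since w - w² = 1, the determinant is 2(1 + r), and (1 + r)² = -r then gives the inverse.
      -- The relation ½ + ½ = 1 lies outside `combination` and is applied last.
      M-unit : Unit (det matM)
      M-unit = unit (- (h * (1# + r) * u)) (trans
        (modulo (solve 5 (λ r w u s h →
          (m₁₁ r w :* :1 :- w :* m₂₁ r w) :* (:- (h :* (:1 :+ r) :* u))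
            := (h :+ h) :+ combination r w u s
                 (:- (:2 :* h :* u)) ((:1 :+ r) :* (:1 :+ r) :* h :* u) (:2 :* h) :0)
          refl r w u s h))
        ½+½≈1)

      kₜ-unit : Unit kₜ
      kₜ-unit = unit ((1# + r) * u) (modulo (solve 4 (λ r w u s →
        κₜ r w :* ((:1 :+ r) :* u) := :1 :+ combination r w u s (:- u) :0 :1 :0)
        refl r w u s))

      -- The quadratic gives (2 + r)(1 + r) = 1, and the equation of w gives (1 - w)w = 1.
      kₛ-unit : Unit kₛ
      kₛ-unit = unit ((1# + r) * w) (modulo (solve 4 (λ r w u s →
        κₛ r w :* ((:1 :+ r) :* w)
          := :1 :+ combination r w u s ((:1 :- w) :* w) (:- :1) :0 :0)
        refl r w u s))

      kᵥ-unit : Unit kᵥ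
      kᵥ-unit = unit (- (h * w * (r - w))) (trans
        (modulo (solve 5 (λ r w u s h →
          κᵥ w s :* (:- (h :* w :* (r :- w)))
            := (h :+ h) :+ combination r w u s
                 :0 (:- (:2 :* h)) :0 (:2 :* h :* (:1 :- w) :* w))
          refl r w u s h))
        ½+½≈1)

      M-T : matM · [ r , 1# ∣ 0# , 1# ] ≋ kₜ ⊙ ([ - 1# , - 1# ∣ - 1# , 0# ] · matM)
      M-T = mk≋
        (modulo (solve 4 (λ r w u s →
          m₁₁ r w :* r :+ w :* :0
            := κₜ r w :* ((:- :1) :* m₁₁ r w :+ (:- :1) :* m₂₁ r w)
                 :+ combination r w u s (:- w) :0 :0 :0) refl r w u s))
        -- The second column needs no relation; it is where the scalar `kₜ` can be read off.
        (solve 2 (λ r w →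
          m₁₁ r w :* :1 :+ w :* :1
            := κₜ r w :* ((:- :1) :* w :+ (:- :1) :* :1)) refl r w)
        (modulo (solve 4 (λ r w u s →
          m₂₁ r w :* r :+ :1 :* :0
            := κₜ r w :* ((:- :1) :* m₁₁ r w :+ :0 :* m₂₁ r w)
                 :+ combination r w u s (:- :1) :0 :0 :0) refl r w u s))
        (solve 2 (λ r w →
          m₂₁ r w :* :1 :+ :1 :* :1
            := κₜ r w :* ((:- :1) :* w :+ :0 :* :1)) refl r w)

      M-S : matM · [ 1# , u ∣ - r + w , - 1# ] ≋ kₛ ⊙ ([ - 1# , 0# ∣ 0# , 1# ] · matM)
      M-S = mk≋
        (modulo (solve 4 (λ r w u s →
          m₁₁ r w :* :1 :+ w :* (:- r :+ w)
            := κₛ r w :* ((:- :1) :* m₁₁ r w :+ :0 :* m₂₁ r w)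
                 :+ combination r w u s (:1 :- w :* w) (:2 :+ r) :0 :0) refl r w u s))
        -- The quadratic gives r⁻¹ = -(r + 3). For m the entry multiplying u, the parts m u of c₁
        -- and -m (r + 3) of c₃ add up to m (u + r + 3), which performs this substitution.
        (modulo (solve 4 (λ r w u s →
          m₁₁ r w :* u :+ w :* (:- :1)
            := κₛ r w :* ((:- :1) :* w :+ :0 :* :1)
                 :+ combination r w u s ((:- w :- :1) :+ m₁₁ r w :* u) (:- :2 :- r) (:- (m₁₁ r w :* (r :+ :3))) :0) refl r w u s))
        (modulo (solve 4 (λ r w u s →
          m₂₁ r w :* :1 :+ :1 :* (:- r :+ w)
            := κₛ r w :* (:0 :* m₁₁ r w :+ :1 :* m₂₁ r w)
                 :+ combination r w u s (w :* w :- w) :1 :0 :0) refl r w u s))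
        (modulo (solve 4 (λ r w u s →
          m₂₁ r w :* u :+ :1 :* (:- :1)
            := κₛ r w :* (:0 :* w :+ :1 :* :1)
                 :+ combination r w u s ((:- w) :+ m₂₁ r w :* u) :0 (:- (m₂₁ r w :* (r :+ :3))) :0) refl r w u s))

      M-V : matM · [ 1# , (1# + u) * s ∣ 1# - r , - 1# ] ≋ kᵥ ⊙ ([ 0# , 1# ∣ - 1# , 0# ] · matM)
      M-V = mk≋
        -- Taking c₄ = -E, with E the part of the left side free of s, rewrites E as E (r - w) s, so
        -- that every term acquires the factor s.
        (modulo (solve 4 (λ r w u s →
          m₁₁ r w :* :1 :+ w :* (:1 :- r)
            := κᵥ w s :* (:0 :* m₁₁ r w :+ :1 :* m₂₁ r w)
                 :+ combination r w u s s (s :* (:- :3 :- :2 :* r)) :0 (:- (m₁₁ r w :* :1 :+ w :* (:1 :- r)))) refl r w u s))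
        (modulo (solve 4 (λ r w u s →
          m₁₁ r w :* ((:1 :+ u) :* s) :+ w :* (:- :1)
            := κᵥ w s :* (:0 :* w :+ :1 :* :1)
                 :+ combination r w u s (s :* ((:- w :- :1) :+ m₁₁ r w :* u)) s (:- (s :* m₁₁ r w :* (r :+ :3))) w) refl r w u s))
        (modulo (solve 4 (λ r w u s →
          m₂₁ r w :* :1 :+ :1 :* (:1 :- r)
            := κᵥ w s :* ((:- :1) :* m₁₁ r w :+ :0 :* m₂₁ r w)
                 :+ combination r w u s (s :* (w :- :1)) (s :* (r :- :1)) :0 (:- (m₂₁ r w :* :1 :+ :1 :* (:1 :- r)))) refl r w u s))
        (modulo (solve 4 (λ r w u s →
          m₂₁ r w :* ((:1 :+ u) :* s) :+ :1 :* (:- :1)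
            := κᵥ w s :* ((:- :1) :* w :+ :0 :* :1)
                 :+ combination r w u s (s :* ((:- w) :+ m₂₁ r w :* u)) (s :* :2) (:- (s :* m₂₁ r w :* (r :+ :3))) :1) refl r w u s))

module Intertwiner {c ℓ₁ ℓ₂} (F : HeytingField c ℓ₁ ℓ₂) where
  open HeytingField F
  private
    R : CommutativeRing c ℓ₁
    R = HeytingCommutativeRing.commutativeRing heytingCommutativeRing
  open Integers R using (fromℤ)
  open Projective R
  open Embedding R using (glℤ)
  open Reciprocals F using (recip-inverseʳ; x#y⇒x-y#0)

  -- The integer products evaluate to the constant matrices in `M-T`, `M-S` and `M-V`, so those
  -- equalities apply as they stand.
  intertwiner : ∀ h w w′ ww′≈1 r r#0 r#w r#w′ → let open Generators.Matrices F w w′ ww′≈1 r r#0 r#w r#w′ in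
    h + h ≈ 1# → w * w - w + 1# ≈ 0# → r * r + fromℤ (+ 3) * r + 1# ≈ 0# →
    ∃[ M ] M ∙ glT ∼ glℤ (K PGLℤ.∙ (U PGLℤ.∙ V)) ∙ M
         × M ∙ glS ∼ glℤ (U PGLℤ.∙ (U PGLℤ.∙ V)) ∙ M
         × M ∙ glV ∼ glℤ (U PGLℤ.∙ V) ∙ M
  intertwiner _ _ _ _ r r#0 r#w _ h+h≈1 w-root r-root =
    gl matM M-unit , scaled kₜ kₜ-unit M-T , scaled kₛ kₛ-unit M-S , scaled kᵥ kᵥ-unit M-V
    where open Conjugator.Relations R r-root w-root (recip-inverseʳ r r#0) (recip-inverseʳ _ (x#y⇒x-y#0 r#w)) h+h≈1

-- Roots of x² + 3x + 1.

module QuadraticRoots {c ℓ₁ ℓ₂} (F : HeytingField c ℓ₁ ℓ₂) where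
  open HeytingField F
  private
    R : CommutativeRing c ℓ₁
    R = HeytingCommutativeRing.commutativeRing heytingCommutativeRing
  open Integers R using (fromℤ)
  open Integers.Solver R
  open Trace R using (*-cancelˡ-unit)
  open Relation.Binary.Reasoning.Setoid setoid

  -- Apartness of a and b decides which factor of (x - a)(x - b) is invertible.
  roots : ∀ {x a b} → a # b → (x - a) * (x - b) ≈ 0# → x ≈ a ⊎ x ≈ b
  roots {x} {a} {b} a#b eq =
    [ (λ a#x → inj₂ (x-y≈0⇒x≈y (*-cancelˡ-unit (#⇒invertible (#-sym a#x)) (trans eq (sym (zeroʳ _))))))
    , (λ x#b → inj₁ (x-y≈0⇒x≈y (*-cancelˡ-unit (#⇒invertible x#b) (trans (*-comm _ _) (trans eq (sym (zeroʳ _)))))))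
    ]′ (#-cotrans a#b x)
    where
    x-y≈0⇒x≈y : ∀ {x y} → x - y ≈ 0# → x ≈ y
    x-y≈0⇒x≈y {x} {y} x-y≈0 = begin
      x          ≈⟨ solve 2 (λ x y → x := (x :- y) :+ y) refl x y ⟩
      x - y + y  ≈⟨ +-congʳ x-y≈0 ⟩
      0# + y     ≈⟨ +-identityˡ y ⟩
      y          ∎

  module _ {p q} (p+q≈1 : p + q ≈ 1#) (pq≈-1 : p * q ≈ - 1#) where

    -- By Vieta: p² + q² = (p + q)² - 2pq = 3 and p²q² = (pq)² = 1.
    [x+p²][x+q²] : ∀ x → (x - - (p * p)) * (x - - (q * q)) ≈ x * x + fromℤ (+ 3) * x + 1#
    [x+p²][x+q²] x = begin
      (x - - (p * p)) * (x - - (q * q))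
        ≈⟨ solve 3 (λ x p q → (x :- (:- (p :* p))) :* (x :- (:- (q :* q)))
             := x :* x :+ ((p :+ q) :* (p :+ q) :- con (+ 2) :* (p :* q)) :* x :+ (p :* q) :* (p :* q)) refl x p q ⟩
      x * x + ((p + q) * (p + q) - fromℤ (+ 2) * (p * q)) * x + (p * q) * (p * q)
        ≈⟨ +-cong (+-congˡ (*-congʳ (+-cong (*-cong p+q≈1 p+q≈1) (-‿cong (*-congˡ pq≈-1))))) (*-cong pq≈-1 pq≈-1) ⟩
      x * x + (1# * 1# - fromℤ (+ 2) * - 1#) * x + - 1# * - 1#
        ≈⟨ solve 1 (λ x → x :* x :+ (con (+ 1) :* con (+ 1) :- con (+ 2) :* (:- con (+ 1))) :* x :+ (:- con (+ 1)) :* (:- con (+ 1))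
             := x :* x :+ con (+ 3) :* x :+ con (+ 1)) refl x ⟩
      x * x + fromℤ (+ 3) * x + 1# ∎

    -p²#-q² : p # q → - (p * p) # - (q * q)
    -p²#-q² p#q = let (z , _ , [p-q]z≈1) = #⇒invertible p#q in
      -- The difference is q² - p² = -(p + q)(p - q) with p + q = 1, so its inverse is minus that of
      -- p - q.
      invertible⇒# (Projective.unit R (- z) (begin
        (- (p * p) - - (q * q)) * - z
          ≈⟨ solve 3 (λ p q z → ((:- (p :* p)) :- (:- (q :* q))) :* (:- z) := (p :+ q) :* ((p :- q) :* z)) refl p q z ⟩
        (p + q) * ((p - q) * z)  ≈⟨ *-cong p+q≈1 [p-q]z≈1 ⟩
        1# * 1#                  ≈⟨ *-identityˡ 1# ⟩
        1#                       ∎))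

    x²+3x+1-roots : p # q → ∀ {x} → x * x + fromℤ (+ 3) * x + 1# ≈ 0# → x ≈ - (p * p) ⊎ x ≈ - (q * q)
    x²+3x+1-roots p#q {x} eq = roots (-p²#-q² p#q) (trans ([x+p²][x+q²] x) eq)

    x≈-p²⇒root : ∀ {x} → x ≈ - (p * p) → x * x + fromℤ (+ 3) * x + 1# ≈ 0#
    x≈-p²⇒root {x} x≈-p² = begin
      x * x + fromℤ (+ 3) * x + 1#       ≈⟨ [x+p²][x+q²] x ⟨
      (x - - (p * p)) * (x - - (q * q))  ≈⟨ *-congʳ (trans (+-congʳ x≈-p²) (-‿inverseʳ _)) ⟩
      0# * (x - - (q * q))               ≈⟨ zeroˡ _ ⟩
      0#                                 ∎

  -- The polynomial w² - w + 1 is palindromic: multiplying it by w⁻² gives the same polynomial in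
  -- w⁻¹. This transfers the equation from ω to ω⁻¹.
  inverse-root : ∀ {w w′} → w * w′ ≈ 1# → w * w - w + 1# ≈ 0# → w′ * w′ - w′ + 1# ≈ 0#
  inverse-root {w} {w′} ww′≈1 eq = begin
    w′ * w′ - w′ + 1#                              ≈⟨ solve 1 (λ v → v :* v :- v :+ con (+ 1) := v :* v :- con (+ 1) :* v :+ con (+ 1) :* con (+ 1)) refl w′ ⟩
    w′ * w′ - 1# * w′ + 1# * 1#                    ≈⟨ +-cong (+-congˡ (-‿cong (*-congʳ ww′≈1))) (*-cong ww′≈1 ww′≈1) ⟨
    w′ * w′ - (w * w′) * w′ + (w * w′) * (w * w′)  ≈⟨ solve 2 (λ w v → v :* v :- (w :* v) :* v :+ (w :* v) :* (w :* v) := (v :* v) :* (w :* w :- w :+ con (+ 1))) refl w w′ ⟩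
    (w′ * w′) * (w * w - w + 1#)                   ≈⟨ trans (*-congˡ eq) (zeroʳ _) ⟩
    0#                                             ∎

-- Arithmetic of φ, its conjugate, and ω.

module Constants where
  open HeytingField ℝ-heytingField
  open Integers ℝ-commutativeRing using (fromℤ)
  open Integers.Solver ℝ-commutativeRing
  open Relation.Binary.Reasoning.Setoid setoid

  private
    h : ℝ
    h = fromℚ ½

  ½+½≈1 : h + h ≈ 1#
  ½+½≈1 = sym (fromℚ-+ ½ ½)

  opaque
    unfolding _+ᴿ_
    -- `√-square` yields the constant sequence 3/1, while `fromℤ (+ 3)` is an iterated sum of ones;
    -- with `_+ᴿ_` unfolded their terms agree by computation.
    √3²≈3 : √ 3 * √ 3 ≈ fromℤ (+ 3)
    √3²≈3 = trans (√-square 3) (pointwise λ _ → ≡.refl)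

    √5²≈5 : √ 5 * √ 5 ≈ fromℤ (+ 5)
    √5²≈5 = trans (√-square 5) (pointwise λ _ → ≡.refl)

  private
    ⅕ : ℝ
    ⅕ = fromℚ (+ 1 ℚ./ 5)

    opaque
      unfolding _+ᴿ_ _*ᴿ_
      5*⅕≈1 : fromℤ (+ 5) * ⅕ ≈ 1#
      5*⅕≈1 = pointwise λ _ → ≡.refl

  -- The difference of the real parts is √5, with inverse √5/5, and an invertible difference means
  -- apartness.
  φ#φ̄ : φ #ᶜ φ̄
  φ#φ̄ = inj₁ (invertible⇒# (Projective.unit ℝ-commutativeRing (√ 5 * ⅕) (begin
    (h * (1# + √ 5) - h * (1# - √ 5)) * (√ 5 * ⅕)
      ≈⟨ solve 3 (λ h s f → (h :* (con (+ 1) :+ s) :- h :* (con (+ 1) :- s)) :* (s :* f) := (h :+ h) :* ((s :* s) :* f)) refl h (√ 5) ⅕ ⟩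
    (h + h) * ((√ 5 * √ 5) * ⅕)  ≈⟨ *-cong ½+½≈1 (trans (*-congʳ √5²≈5) 5*⅕≈1) ⟩
    1# * 1#                      ≈⟨ *-identityˡ 1# ⟩
    1#                           ∎)))

  φ+φ̄≈1 : φ +ᶜ φ̄ ≈ᶜ 1ᶜ
  φ+φ̄≈1 = mk≈ᶜ
    (trans (solve 2 (λ h s → h :* (con (+ 1) :+ s) :+ h :* (con (+ 1) :- s) := h :+ h) refl h (√ 5)) ½+½≈1)
    (+-identityˡ 0#)

  φφ̄≈-1 : φ *ᶜ φ̄ ≈ᶜ -ᶜ 1ᶜ
  φφ̄≈-1 = mk≈ᶜ
    (begin
      h * (1# + √ 5) * (h * (1# - √ 5)) - 0# * 0#
        ≈⟨ solve 2 (λ h s → h :* (con (+ 1) :+ s) :* (h :* (con (+ 1) :- s)) :- con (+ 0) :* con (+ 0) := h :* h :- h :* h :* (s :* s)) refl h (√ 5) ⟩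
      h * h - h * h * (√ 5 * √ 5)  ≈⟨ +-congˡ (-‿cong (*-congˡ √5²≈5)) ⟩
      -- (1 - 5)h² = -(2h)².
      h * h - h * h * fromℤ (+ 5)  ≈⟨ solve 1 (λ h → h :* h :- h :* h :* con (+ 5) := :- ((h :+ h) :* (h :+ h))) refl h ⟩
      - ((h + h) * (h + h))        ≈⟨ -‿cong (*-cong ½+½≈1 ½+½≈1) ⟩
      - (1# * 1#)                  ≈⟨ -‿cong (*-identityˡ 1#) ⟩
      - 1#                         ∎)
    (solve 2 (λ p q → p :* con (+ 0) :+ con (+ 0) :* q := :- con (+ 0)) refl (h * (1# + √ 5)) (h * (1# - √ 5)))

  -- The sixth cyclotomic polynomial vanishes at ω. In coordinates this comes down to √3² = 3 and ½
  -- + ½ = 1.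
  ω²-ω+1≈0 : (ω *ᶜ ω) -ᶜ ω +ᶜ 1ᶜ ≈ᶜ 0ᶜ
  ω²-ω+1≈0 = mk≈ᶜ
    (begin
      h * h - h * √ 3 * (h * √ 3) - h + 1#
        ≈⟨ solve 2 (λ h s → h :* h :- h :* s :* (h :* s) :- h :+ con (+ 1) := h :* h :- h :* h :* (s :* s) :- h :+ con (+ 1)) refl h (√ 3) ⟩
      h * h - h * h * (√ 3 * √ 3) - h + 1#  ≈⟨ +-congʳ (+-congʳ (+-congˡ (-‿cong (*-congˡ √3²≈3)))) ⟩
      h * h - h * h * fromℤ (+ 3) - h + 1#  ≈⟨ solve 1 (λ h → h :* h :- h :* h :* con (+ 3) :- h :+ con (+ 1) := con (+ 1) :- h :- h :* (h :+ h)) refl h ⟩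
      1# - h - h * (h + h)                  ≈⟨ +-congˡ (-‿cong (*-congˡ ½+½≈1)) ⟩
      1# - h - h * 1#                       ≈⟨ solve 1 (λ h → con (+ 1) :- h :- h :* con (+ 1) := con (+ 1) :- (h :+ h)) refl h ⟩
      1# - (h + h)                          ≈⟨ +-congˡ (-‿cong ½+½≈1) ⟩
      1# - 1#                               ≈⟨ -‿inverseʳ 1# ⟩
      0#                                    ∎)
    (begin
      h * (h * √ 3) + h * √ 3 * h - h * √ 3 + 0#
        ≈⟨ solve 2 (λ h s → h :* (h :* s) :+ h :* s :* h :- h :* s :+ con (+ 0) := (h :+ h) :* (h :* s) :- h :* s) refl h (√ 3) ⟩
      (h + h) * (h * √ 3) - h * √ 3  ≈⟨ +-congʳ (trans (*-congʳ ½+½≈1) (*-identityˡ _)) ⟩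
      h * √ 3 - h * √ 3              ≈⟨ -‿inverseʳ _ ⟩
      0#                             ∎)

  ½ᶜ+½ᶜ≈1 : (h +i 0#) +ᶜ (h +i 0#) ≈ᶜ 1ᶜ
  ½ᶜ+½ᶜ≈1 = mk≈ᶜ ½+½≈1 (+-identityˡ 0#)

ω^-root : ∀ ± → (ω^ ± *ᶜ ω^ ±) -ᶜ ω^ ± +ᶜ 1ᶜ ≈ᶜ 0ᶜ
ω^-root Sign.+ = Constants.ω²-ω+1≈0
ω^-root Sign.- = QuadraticRoots.inverse-root ℂ-heytingField (ω^-inverse Sign.+) Constants.ω²-ω+1≈0

-- From generators to conjugacy with α, and the equivalence.

-- The target group is kept abstract: unification would unfold the operations of PGL₂(ℂ).
module ConjugacyToDyer {c ℓ} (G : Group c ℓ) where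
  open Group G
  open Conjugation G
  open GroupMorphisms (Group.rawGroup PGL₂ℤ) rawGroup

  module Homomorphisms {Ψ ι : PGLℤ.GL₂ → Carrier} (Ψ-hom : IsGroupHomomorphism Ψ) (ι-hom : IsGroupHomomorphism ι)
    {α : PGLℤ.GL₂ → PGLℤ.GL₂} (α-dyer : IsDyerAutomorphism α) where
    open IsDyerAutomorphism α-dyer
    private
      module α = GroupMorphisms.IsGroupIsomorphism isAutomorphism
      module ι = IsGroupHomomorphism ι-hom

      ια-hom : IsGroupHomomorphism (ι ∘ α)
      ια-hom = isGroupHomomorphism trans α.isGroupHomomorphism ι-hom

      xΨx⁻¹-hom : ∀ x → IsGroupHomomorphism (λ g → x ∙ Ψ g ∙ x ⁻¹)
      xΨx⁻¹-hom x = isGroupHomomorphism trans Ψ-hom (conjugation-isGroupHomomorphism x)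

    α-T : α T PGLℤ.∼ K PGLℤ.∙ (U PGLℤ.∙ V)
    α-T = PGLℤ.∼-trans (α.⟦⟧-cong Generation.T∼K∙V) (PGLℤ.∼-trans (α.∙-homo K V) (PGLℤ.∙-cong α-K α-V))

    α-S : α S PGLℤ.∼ U PGLℤ.∙ (U PGLℤ.∙ V)
    α-S = PGLℤ.∼-trans (α.⟦⟧-cong Generation.S∼U∙V) (PGLℤ.∼-trans (α.∙-homo U V) (PGLℤ.∙-cong α-U α-V))

    -- Agreement at U, K and V passes to the products T = KV and S = UV, and then T, S, V determine
    -- both homomorphisms.
    conjugates⇔ : ∀ x → (∀ g → x ∙ Ψ g ∙ x ⁻¹ ≈ ι (α g)) ⇔
                  (x ∙ Ψ U ∙ x ⁻¹ ≈ ι U × x ∙ Ψ K ∙ x ⁻¹ ≈ ι K × x ∙ Ψ V ∙ x ⁻¹ ≈ ι (U PGLℤ.∙ V))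
    conjugates⇔ x = mk⇔
      (λ eq → trans (eq U) (ι.⟦⟧-cong α-U) , trans (eq K) (ι.⟦⟧-cong α-K) , trans (eq V) (ι.⟦⟧-cong α-V))
      (λ (eqU , eqK , eqV) →
        let onU = trans eqU (sym (ι.⟦⟧-cong α-U))
            onK = trans eqK (sym (ι.⟦⟧-cong α-K))
            onV = trans eqV (sym (ι.⟦⟧-cong α-V))
        in Generation.homomorphisms-agree G (xΨx⁻¹-hom x) ια-hom
             (product Generation.T∼K∙V onK onV) (product Generation.S∼U∙V onU onV) onV)
      where
      module F = IsGroupHomomorphism (xΨx⁻¹-hom x)
      module H = IsGroupHomomorphism ια-hom
      product : ∀ {A B C} → A PGLℤ.∼ B PGLℤ.∙ C → x ∙ Ψ B ∙ x ⁻¹ ≈ ι (α B) → x ∙ Ψ C ∙ x ⁻¹ ≈ ι (α C) →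
                x ∙ Ψ A ∙ x ⁻¹ ≈ ι (α A)
      product {A} {B} {C} A∼BC onB onC = trans (F.⟦⟧-cong A∼BC) (trans (F.homo B C)
        (trans (∙-cong onB onC) (sym (trans (H.⟦⟧-cong A∼BC) (H.homo B C)))))

    conjugates-T : ∀ {x t} → Ψ T ≈ t → x ∙ Ψ T ∙ x ⁻¹ ≈ ι (α T) → x ∙ t ∙ x ⁻¹ ≈ ι (K PGLℤ.∙ (U PGLℤ.∙ V))
    conjugates-T ΨT≈t eq = trans (∙-congʳ (∙-congˡ (sym ΨT≈t))) (trans eq (ι.⟦⟧-cong α-T))

    intertwines⇒conjugates : ∀ {x t s v} → Ψ T ≈ t → Ψ S ≈ s → Ψ V ≈ v →
      x ∙ t ≈ ι (K PGLℤ.∙ (U PGLℤ.∙ V)) ∙ x → x ∙ s ≈ ι (U PGLℤ.∙ (U PGLℤ.∙ V)) ∙ x → x ∙ v ≈ ι (U PGLℤ.∙ V) ∙ x →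
      ∀ g → x ∙ Ψ g ∙ x ⁻¹ ≈ ι (α g)
    intertwines⇒conjugates {x} ΨT≈t ΨS≈s ΨV≈v xt xs xv = Generation.homomorphisms-agree G (xΨx⁻¹-hom x) ια-hom
      (conjugates ΨT≈t α-T xt) (conjugates ΨS≈s α-S xs) (conjugates ΨV≈v α-V xv)
      where
      conjugates : ∀ {g y B} → Ψ g ≈ y → α g PGLℤ.∼ B → x ∙ y ≈ ι B ∙ x → x ∙ Ψ g ∙ x ⁻¹ ≈ ι (α g)
      conjugates Ψg≈y αg∼B xy≈Bx = trans (∙-congʳ (∙-congˡ Ψg≈y)) (trans (xy≈zx⇒xyx⁻¹≈z xy≈Bx) (sym (ι.⟦⟧-cong αg∼B)))

module _ (± : Sign) (r : ℂ) (r#0 : r #ᶜ 0ᶜ) (r#ω^ : ∀ s → r #ᶜ ω^ s)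
         {Ψ : PGLℤ.GL₂ → PGLℂ.GL₂} (Ψ-rep : Representation.IsΨ ± r r#0 r#ω^ Ψ)
         {α : PGLℤ.GL₂ → PGLℤ.GL₂} (α-dyer : IsDyerAutomorphism α) where
  open PGLℂ
  open Representation ± r r#0 r#ω^
  open IsΨ Ψ-rep
  open Integers ℂ-commutativeRing using (fromℤ)
  private
    module C = ConjugacyToDyer.Homomorphisms PGL₂ℂ isHomomorphism (EmbeddingProperties.glℤ-isGroupHomomorphism ℂ-commutativeRing) α-dyer

  -- Conjugacy at the single element T already forces the quadratic equation.
  conjugate⇒root : ∀ M → M ∙ Ψ T ∙ M ⁻¹ ∼ ι (α T) → r *ᶜ r +ᶜ fromℤ (+ 3) *ᶜ r +ᶜ 1ᶜ ≈ᶜ 0ᶜ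
  conjugate⇒root M eq = tr²/det-T⇒root
    (conjugate⇒tr²/det {M} {glT} {ι (K PGLℤ.∙ (U PGLℤ.∙ V))} (C.conjugates-T {M} {glT} Ψ-T eq))
    where open Trace ℂ-commutativeRing

  root⇒conjugate : r *ᶜ r +ᶜ fromℤ (+ 3) *ᶜ r +ᶜ 1ᶜ ≈ᶜ 0ᶜ → ∃[ M ] ∀ g → M ∙ Ψ g ∙ M ⁻¹ ∼ ι (α g)
  root⇒conjugate root =
    let (M , MT , MS , MV) = Intertwiner.intertwiner ℂ-heytingField
          (fromℚ ½ +i 0ᴿ) (ω^ ±) (ω^ (Sign.opposite ±)) (ω^-inverse ±) r r#0 (r#ω^ ±) (r#ω^ (Sign.opposite ±))
          Constants.½ᶜ+½ᶜ≈1 (ω^-root ±) root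
    in M , C.intertwines⇒conjugates {M} {glT} {glS} {glV} Ψ-T Ψ-S Ψ-V MT MS MV

mainTheorem12 : (± : Sign) (r : ℂ) (r#0 : r #ᶜ 0ᶜ) (r#ω^ : ∀ s → r #ᶜ ω^ s)
    (Ψ : PGLℤ.GL₂ → PGLℂ.GL₂) → Representation.IsΨ ± r r#0 r#ω^ Ψ →
    (α : PGLℤ.GL₂ → PGLℤ.GL₂) → IsDyerAutomorphism α →
    let open PGLℂ in
    ((∃[ M ] (∀ g → M ∙ Ψ g ∙ M ⁻¹ ∼ ι (α g))) ⇔ (r ≈ᶜ -ᶜ (φ *ᶜ φ) ⊎ r ≈ᶜ -ᶜ (φ̄ *ᶜ φ̄)))
    × (∀ M → (∀ g → M ∙ Ψ g ∙ M ⁻¹ ∼ ι (α g)) ⇔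
    (M ∙ Ψ U ∙ M ⁻¹ ∼ ι U × M ∙ Ψ K ∙ M ⁻¹ ∼ ι K × M ∙ Ψ V ∙ M ⁻¹ ∼ ι (U PGLℤ.∙ V)))
mainTheorem12 ± r r#0 r#ω^ Ψ Ψ-rep α α-dyer =
  mk⇔ (λ (M , eq) → x²+3x+1-roots {φ} {φ̄} φ+φ̄≈1 φφ̄≈-1 φ#φ̄ (conjugate⇒root ± r r#0 r#ω^ Ψ-rep α-dyer M (eq T)))
      (λ r≈ → root⇒conjugate ± r r#0 r#ω^ Ψ-rep α-dyer
        ([ x≈-p²⇒root {φ} {φ̄} φ+φ̄≈1 φφ̄≈-1
         -- Sum and product are symmetric, so exchanging the two numbers handles the other root.
         , x≈-p²⇒root {φ̄} {φ} (≈-trans (+-comm φ̄ φ) φ+φ̄≈1) (≈-trans (*-comm φ̄ φ) φφ̄≈-1) ]′ r≈))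
  , ConjugacyToDyer.Homomorphisms.conjugates⇔ PGL₂ℂ (Representation.IsΨ.isHomomorphism Ψ-rep)
      (EmbeddingProperties.glℤ-isGroupHomomorphism ℂ-commutativeRing) α-dyer
  where
  open QuadraticRoots ℂ-heytingField
  open Constants
  open CommutativeRing ℂ-commutativeRing using (+-comm; *-comm) renaming (trans to ≈-trans)
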